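{- Let $G_1$ be a $(q_1,q_2)$-semi-regular bipartite graph with bipartition $V_1,V_2$, $|V_1|=n_1\le n_2=|V_2|$, and put $\nu_1=n_1+n_2$, $\epsilon_1=n_1q_1=n_2q_2$. Let $G_2$ be a $(q_3,q_4)$-semi-regular bipartite graph with bipartition $V_3,V_4$, $|V_3|=n_3\le n_4=|V_4|$, and put $\nu_2=n_3+n_4$, $\epsilon_2=n_3q_3=n_4q_4$. Write the adjacency spectra as multisets $$spec(G_1)=\{\pm\lambda_1,\dots,\pm\lambda_{k_1},\underbrace{0,\dots,0}_{\nu_1-2k_1}\},\qquad spec(G_2)=\{\pm\mu_1,\dots,\pm\mu_{k_2},\underbrace{0,\dots,0}_{\nu_2-2k_2}\},$$ where $k_1$ (resp. $k_2$) is the number of positive eigenvalues of $G_1$ (resp. $G_2$), $\sqrt{q_1q_2}=\lambda_1\ge\lambda_2\ge\dots\ge\lambda_{k_1}>0$ and $\sqrt{q_3q_4}=\mu_1\ge\mu_2\ge\dots\ge\mu_{k_2}>0$. Let $G=G_1\vee G_2$ and let $\theta_1,\theta_2,\theta_3,\theta_4$ be the zeros of $$f(\lambda)=\lambda^4-(q_1q_2+q_3q_4+\nu_1\nu_2)\lambda^2-2(\nu_1\epsilon_2+\nu_2\epsilon_1)\lambda+q_1q_2q_3q_4-4\epsilon_1\epsilon_2.$$ Then, as multisets, $$spec(G)=\{\theta_1,\theta_2,\theta_3,\theta_4,\pm\lambda_2,\dots,\pm\lambda_{k_1},\pm\mu_2,\dots,\pm\mu_{k_2},\underbrace{0,\d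ots,0}_{\nu_1-2k_1+\nu_2-2k_2}\}.$$
   Context: A bipartite graph with bipartition $(V_1,V_2)$ is $(q_1,q_2)$-semi-regular if every vertex of $V_1$ has degree $q_1$ and every vertex of $V_2$ has degree $q_2$ (here $q_1,q_2\ge 1$). The join $G_1\vee G_2$ has vertex set $V(G_1)\cup V(G_2)$ (disjoint) and edge set $E(G_1)\cup E(G_2)\cup\{uv: u\in V(G_1), v\in V(G_2)\}$. The spectrum $spec(G)$ of a graph is the multiset of eigenvalues of its adjacency matrix. It is a known fact that the spectrum of a $(q_1,q_2)$-semi-regular bipartite graph is symmetric about $0$ with largest eigenvalue $\sqrt{q_1q_2}$, so the displayed forms of $spec(G_1)$, $spec(G_2)$ are notation. -}

module Defs where

open import Algebra.Bundles using (CommutativeMonoid)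
open import Algebra.Bundles.Raw using (RawRing)
import Algebra.Definitions.RawSemiring as RawSemiringDefs
import Algebra.Properties.CommutativeSemigroup as CommutativeSemigroupProperties
open import Data.Bool.Base using (Bool; true; false; if_then_else_)
open import Data.Fin.Base using (Fin; zero; suc; toℕ; punchIn; splitAt)
open import Data.Fin.Properties using (_≟_)
open import Data.Fin.Subset using (Subset; _∈_; ∣_∣)
open import Data.List.Base using (List; []; _∷_; map; foldr; concatMap)
open import Data.Nat.Base as ℕ using (ℕ; zero; suc)
import Data.Nat.Properties as ℕₚ
open import Data.Product.Base using (∃-syntax; _×_; _,_; proj₁; proj₂)
open import Data.Rational.Base as ℚ using (ℚ; 0ℚ; 1ℚ; ½)
import Data.Rational.Properties as ℚₚ
open import Data.Sum.Base using (_⊎_; inj₁; inj₂)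
open import Data.Vec.Base using (tabulate)
open import Level using (0ℓ)
open import Relation.Binary.PropositionalEquality using (_≡_; refl; sym; trans; cong; cong₂; subst; module ≡-Reasoning)
open import Relation.Nullary using (¬_; does)

------------------------------------------------------------------------
-- Real numbers: Cauchy sequences of rationals, with x ≈ y meaning that
-- x − y tends to 0.

Eventually : (ℕ → Set) → Set
Eventually P = ∃[ N ] (∀ n → N ℕ.≤ n → P n)

IsCauchy : (ℕ → ℚ) → Set
IsCauchy x = ∀ ε → 0ℚ ℚ.< ε →
  ∃[ N ] (∀ m n → N ℕ.≤ m → N ℕ.≤ n → ℚ.∣ x m ℚ.- x n ∣ ℚ.< ε)

record ℝ : Set where
  constructor mkℝ
  field
    seq    : ℕ → ℚ
    cauchy : IsCauchy seq

open ℝ public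

-+-cancel : ∀ p q → p ℚ.- q ℚ.+ q ≡ p
-+-cancel p q = trans (ℚₚ.+-assoc p (ℚ.- q) q)
  (trans (cong (p ℚ.+_) (ℚₚ.+-inverseˡ q)) (ℚₚ.+-identityʳ p))

*-distribˡ-- : ∀ p q r → p ℚ.* q ℚ.- p ℚ.* r ≡ p ℚ.* (q ℚ.- r)
*-distribˡ-- p q r = trans (cong (p ℚ.* q ℚ.+_) (ℚₚ.neg-distribʳ-* p r))
  (sym (ℚₚ.*-distribˡ-+ p q (ℚ.- r)))

+-interchange : ∀ p q r s → (p ℚ.+ q) ℚ.+ (r ℚ.+ s) ≡ (p ℚ.+ r) ℚ.+ (q ℚ.+ s)
+-interchange = CommutativeSemigroupProperties.interchange
  (CommutativeMonoid.commutativeSemigroup ℚₚ.+-0-commutativeMonoid)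

const-cauchy : ∀ q → IsCauchy (λ _ → q)
const-cauchy q ε 0<ε = 0 , λ _ _ _ _ →
  subst (ℚ._< ε) (sym (cong ℚ.∣_∣ (ℚₚ.+-inverseʳ q))) 0<ε

neg-cauchy : ∀ x → IsCauchy x → IsCauchy (λ n → ℚ.- x n)
neg-cauchy x cx ε 0<ε with cx ε 0<ε
... | N , h = N , λ m n N≤m N≤n → subst (ℚ._< ε) (eq m n) (h m n N≤m N≤n)
  where
  eq : ∀ m n → ℚ.∣ x m ℚ.- x n ∣ ≡ ℚ.∣ ℚ.- x m ℚ.- (ℚ.- x n) ∣
  eq m n = trans (sym (ℚₚ.∣-p∣≡∣p∣ (x m ℚ.- x n))) (cong ℚ.∣_∣ (ℚₚ.neg-distrib-+ (x m) (ℚ.- x n)))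

+-cauchy : ∀ x y → IsCauchy x → IsCauchy y → IsCauchy (λ n → x n ℚ.+ y n)
+-cauchy x y cx cy ε 0<ε = N₁ ℕ.⊔ N₂ , bound
  where
  δ : ℚ
  δ = ½ ℚ.* ε

  0<δ : 0ℚ ℚ.< δ
  0<δ = subst (ℚ._< δ) (ℚₚ.*-zeroʳ ½) (ℚₚ.*-monoʳ-<-pos ½ 0<ε)

  N₁ = proj₁ (cx δ 0<δ)
  N₂ = proj₁ (cy δ 0<δ)

  δ+δ≡ε : δ ℚ.+ δ ≡ ε
  δ+δ≡ε = trans (sym (ℚₚ.*-distribʳ-+ ε ½ ½)) (ℚₚ.*-identityˡ ε)

  bound : ∀ m n → N₁ ℕ.⊔ N₂ ℕ.≤ m → N₁ ℕ.⊔ N₂ ℕ.≤ n →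
          ℚ.∣ (x m ℚ.+ y m) ℚ.- (x n ℚ.+ y n) ∣ ℚ.< ε
  bound m n N≤m N≤n = begin-strict
    ℚ.∣ (x m ℚ.+ y m) ℚ.- (x n ℚ.+ y n) ∣      ≡⟨ cong ℚ.∣_∣ split ⟩
    ℚ.∣ (x m ℚ.- x n) ℚ.+ (y m ℚ.- y n) ∣      ≤⟨ ℚₚ.∣p+q∣≤∣p∣+∣q∣ (x m ℚ.- x n) (y m ℚ.- y n) ⟩
    ℚ.∣ x m ℚ.- x n ∣ ℚ.+ ℚ.∣ y m ℚ.- y n ∣    <⟨ ℚₚ.+-mono-<
                                                    (proj₂ (cx δ 0<δ) m n (ℕₚ.m⊔n≤o⇒m≤o N₁ N₂ N≤m) (ℕₚ.m⊔n≤o⇒m≤o N₁ N₂ N≤n))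
                                                    (proj₂ (cy δ 0<δ) m n (ℕₚ.m⊔n≤o⇒n≤o N₁ N₂ N≤m) (ℕₚ.m⊔n≤o⇒n≤o N₁ N₂ N≤n)) ⟩
    δ ℚ.+ δ                                    ≡⟨ δ+δ≡ε ⟩
    ε                                          ∎
    where
    open ℚₚ.≤-Reasoning
    split : (x m ℚ.+ y m) ℚ.- (x n ℚ.+ y n) ≡ (x m ℚ.- x n) ℚ.+ (y m ℚ.- y n)
    split = trans (cong (x m ℚ.+ y m ℚ.+_) (ℚₚ.neg-distrib-+ (x n) (y n)))
                  (+-interchange (x m) (y m) (ℚ.- x n) (ℚ.- y n))

cauchy⇒bounded : ∀ x → IsCauchy x →
  ∃[ B ] (ℚ.Positive B × Eventually (λ n → ℚ.∣ x n ∣ ℚ.≤ B))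
cauchy⇒bounded x cx = B , B-pos , N , bound
  where
  0<1 : 0ℚ ℚ.< 1ℚ
  0<1 = ℚₚ.positive⁻¹ 1ℚ

  N = proj₁ (cx 1ℚ 0<1)

  B : ℚ
  B = 1ℚ ℚ.+ ℚ.∣ x N ∣

  B-pos : ℚ.Positive B
  B-pos = ℚₚ.pos+nonNeg⇒pos 1ℚ ℚ.∣ x N ∣ {{ℚₚ.∣-∣-nonNeg (x N)}}

  bound : ∀ n → N ℕ.≤ n → ℚ.∣ x n ∣ ℚ.≤ B
  bound n N≤n = begin
    ℚ.∣ x n ∣                          ≡⟨ cong ℚ.∣_∣ split ⟩
    ℚ.∣ (x n ℚ.- x N) ℚ.+ x N ∣        ≤⟨ ℚₚ.∣p+q∣≤∣p∣+∣q∣ (x n ℚ.- x N) (x N) ⟩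
    ℚ.∣ x n ℚ.- x N ∣ ℚ.+ ℚ.∣ x N ∣    ≤⟨ ℚₚ.+-monoˡ-≤ ℚ.∣ x N ∣ (ℚₚ.<⇒≤ (proj₂ (cx 1ℚ 0<1) n N N≤n ℕₚ.≤-refl)) ⟩
    B                                  ∎
    where
    open ℚₚ.≤-Reasoning
    split : x n ≡ (x n ℚ.- x N) ℚ.+ x N
    split = sym (-+-cancel (x n) (x N))

*-cauchy : ∀ x y → IsCauchy x → IsCauchy y → IsCauchy (λ n → x n ℚ.* y n)
*-cauchy x y cx cy ε 0<ε with cauchy⇒bounded x cx | cauchy⇒bounded y cy
... | B , B-pos , N₁ , x≤B | C , C-pos , N₂ , y≤C =
  (N₁ ℕ.⊔ N₂) ℕ.⊔ (N₃ ℕ.⊔ N₄) , bound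
  where
  instance
    _ = B-pos
    _ = C-pos
    S-pos = ℚₚ.pos+pos⇒pos B C
    S≢0 = ℚₚ.pos⇒nonZero (B ℚ.+ C)
    S⁻¹-pos = ℚₚ.1/pos⇒pos (B ℚ.+ C)

  δ : ℚ
  δ = (ℚ.1/ (B ℚ.+ C)) ℚ.* ε

  0<δ : 0ℚ ℚ.< δ
  0<δ = subst (ℚ._< δ) (ℚₚ.*-zeroʳ (ℚ.1/ (B ℚ.+ C))) (ℚₚ.*-monoʳ-<-pos (ℚ.1/ (B ℚ.+ C)) 0<ε)

  N₃ = proj₁ (cx δ 0<δ)
  N₄ = proj₁ (cy δ 0<δ)

  total : B ℚ.* δ ℚ.+ C ℚ.* δ ≡ ε
  total = begin
    B ℚ.* δ ℚ.+ C ℚ.* δ                        ≡⟨ ℚₚ.*-distribʳ-+ δ B C ⟨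
    (B ℚ.+ C) ℚ.* δ                            ≡⟨ ℚₚ.*-assoc (B ℚ.+ C) (ℚ.1/ (B ℚ.+ C)) ε ⟨
    (B ℚ.+ C) ℚ.* (ℚ.1/ (B ℚ.+ C)) ℚ.* ε       ≡⟨ cong (ℚ._* ε) (ℚₚ.*-inverseʳ (B ℚ.+ C)) ⟩
    1ℚ ℚ.* ε                                   ≡⟨ ℚₚ.*-identityˡ ε ⟩
    ε                                          ∎
    where open ≡-Reasoning

  scale : ∀ D → .{{ℚ.Positive D}} → ∀ p q → ℚ.∣ p ∣ ℚ.≤ D → ℚ.∣ q ∣ ℚ.< δ →
          ℚ.∣ p ℚ.* q ∣ ℚ.< D ℚ.* δ
  scale D p q p≤D q<δ = begin-strict
    ℚ.∣ p ℚ.* q ∣            ≡⟨ ℚₚ.∣p*q∣≡∣p∣*∣q∣ p q ⟩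
    ℚ.∣ p ∣ ℚ.* ℚ.∣ q ∣      ≤⟨ ℚₚ.*-monoʳ-≤-nonNeg ℚ.∣ q ∣ {{ℚₚ.∣-∣-nonNeg q}} p≤D ⟩
    D ℚ.* ℚ.∣ q ∣            <⟨ ℚₚ.*-monoʳ-<-pos D q<δ ⟩
    D ℚ.* δ                  ∎
    where open ℚₚ.≤-Reasoning

  bound : ∀ m n → (N₁ ℕ.⊔ N₂) ℕ.⊔ (N₃ ℕ.⊔ N₄) ℕ.≤ m → (N₁ ℕ.⊔ N₂) ℕ.⊔ (N₃ ℕ.⊔ N₄) ℕ.≤ n →
          ℚ.∣ x m ℚ.* y m ℚ.- x n ℚ.* y n ∣ ℚ.< ε
  bound m n N≤m N≤n = begin-strict
    ℚ.∣ x m ℚ.* y m ℚ.- x n ℚ.* y n ∣                              ≡⟨ cong ℚ.∣_∣ split ⟩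
    ℚ.∣ x m ℚ.* (y m ℚ.- y n) ℚ.+ y n ℚ.* (x m ℚ.- x n) ∣          ≤⟨ ℚₚ.∣p+q∣≤∣p∣+∣q∣ (x m ℚ.* (y m ℚ.- y n)) (y n ℚ.* (x m ℚ.- x n)) ⟩
    ℚ.∣ x m ℚ.* (y m ℚ.- y n) ∣ ℚ.+ ℚ.∣ y n ℚ.* (x m ℚ.- x n) ∣    <⟨ ℚₚ.+-mono-<
        (scale B (x m) (y m ℚ.- y n) (x≤B m (from₁ N≤m)) (proj₂ (cy δ 0<δ) m n (from₄ N≤m) (from₄ N≤n)))
        (scale C (y n) (x m ℚ.- x n) (y≤C n (from₂ N≤n)) (proj₂ (cx δ 0<δ) m n (from₃ N≤m) (from₃ N≤n))) ⟩
    B ℚ.* δ ℚ.+ C ℚ.* δ                                            ≡⟨ total ⟩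
    ε                                                              ∎
    where
    open ℚₚ.≤-Reasoning
    split : x m ℚ.* y m ℚ.- x n ℚ.* y n ≡ x m ℚ.* (y m ℚ.- y n) ℚ.+ y n ℚ.* (x m ℚ.- x n)
    split = begin-equality
      a ℚ.* b ℚ.- c ℚ.* d                                           ≡⟨ cong (ℚ._- c ℚ.* d) (-+-cancel (a ℚ.* b) (a ℚ.* d)) ⟨
      a ℚ.* b ℚ.- a ℚ.* d ℚ.+ a ℚ.* d ℚ.- c ℚ.* d                   ≡⟨ ℚₚ.+-assoc (a ℚ.* b ℚ.- a ℚ.* d) (a ℚ.* d) (ℚ.- (c ℚ.* d)) ⟩
      (a ℚ.* b ℚ.- a ℚ.* d) ℚ.+ (a ℚ.* d ℚ.- c ℚ.* d)               ≡⟨ cong₂ ℚ._+_ (*-distribˡ-- a b d) eq ⟩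
      a ℚ.* (b ℚ.- d) ℚ.+ d ℚ.* (a ℚ.- c)                           ∎
      where
      a = x m
      b = y m
      c = x n
      d = y n
      eq : a ℚ.* d ℚ.- c ℚ.* d ≡ d ℚ.* (a ℚ.- c)
      eq = trans (cong₂ ℚ._-_ (ℚₚ.*-comm a d) (ℚₚ.*-comm c d)) (*-distribˡ-- d a c)
    from₁₂ : ∀ {k} → (N₁ ℕ.⊔ N₂) ℕ.⊔ (N₃ ℕ.⊔ N₄) ℕ.≤ k → N₁ ℕ.⊔ N₂ ℕ.≤ k
    from₁₂ = ℕₚ.m⊔n≤o⇒m≤o (N₁ ℕ.⊔ N₂) (N₃ ℕ.⊔ N₄)
    from₃₄ : ∀ {k} → (N₁ ℕ.⊔ N₂) ℕ.⊔ (N₃ ℕ.⊔ N₄) ℕ.≤ k → N₃ ℕ.⊔ N₄ ℕ.≤ k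
    from₃₄ = ℕₚ.m⊔n≤o⇒n≤o (N₁ ℕ.⊔ N₂) (N₃ ℕ.⊔ N₄)
    from₁ : ∀ {k} → (N₁ ℕ.⊔ N₂) ℕ.⊔ (N₃ ℕ.⊔ N₄) ℕ.≤ k → N₁ ℕ.≤ k
    from₁ le = ℕₚ.m⊔n≤o⇒m≤o N₁ N₂ (from₁₂ le)
    from₂ : ∀ {k} → (N₁ ℕ.⊔ N₂) ℕ.⊔ (N₃ ℕ.⊔ N₄) ℕ.≤ k → N₂ ℕ.≤ k
    from₂ le = ℕₚ.m⊔n≤o⇒n≤o N₁ N₂ (from₁₂ le)
    from₃ : ∀ {k} → (N₁ ℕ.⊔ N₂) ℕ.⊔ (N₃ ℕ.⊔ N₄) ℕ.≤ k → N₃ ℕ.≤ k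
    from₃ le = ℕₚ.m⊔n≤o⇒m≤o N₃ N₄ (from₃₄ le)
    from₄ : ∀ {k} → (N₁ ℕ.⊔ N₂) ℕ.⊔ (N₃ ℕ.⊔ N₄) ℕ.≤ k → N₄ ℕ.≤ k
    from₄ le = ℕₚ.m⊔n≤o⇒n≤o N₃ N₄ (from₃₄ le)

record _≈ℝ_ (x y : ℝ) : Set where
  constructor mk≈ℝ
  field
    difference-null : ∀ ε → 0ℚ ℚ.< ε → Eventually (λ n → ℚ.∣ seq x n ℚ.- seq y n ∣ ℚ.< ε)

_+ℝ_ : ℝ → ℝ → ℝ
mkℝ x cx +ℝ mkℝ y cy = mkℝ (λ n → x n ℚ.+ y n) (+-cauchy x y cx cy)

_*ℝ_ : ℝ → ℝ → ℝ
mkℝ x cx *ℝ mkℝ y cy = mkℝ (λ n → x n ℚ.* y n) (*-cauchy x y cx cy)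

-ℝ_ : ℝ → ℝ
-ℝ mkℝ x cx = mkℝ (λ n → ℚ.- x n) (neg-cauchy x cx)

constℝ : ℚ → ℝ
constℝ q = mkℝ (λ _ → q) (const-cauchy q)

ℝ-rawRing : RawRing 0ℓ 0ℓ
ℝ-rawRing = record
  { Carrier = ℝ
  ; _≈_     = _≈ℝ_
  ; _+_     = _+ℝ_
  ; _*_     = _*ℝ_
  ; -_      = -ℝ_
  ; 0#      = constℝ 0ℚ
  ; 1#      = constℝ 1ℚ
  }

module ℝ-Ring = RawRing ℝ-rawRing

0ℝ : ℝ
0ℝ = constℝ 0ℚ

infix 4 _<_ _≤_ _≥_

_<_ : ℝ → ℝ → Set
x < y = ∃[ ε ] (0ℚ ℚ.< ε × Eventually (λ n → seq x n ℚ.+ ε ℚ.≤ seq y n))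

_≤_ : ℝ → ℝ → Set
x ≤ y = ¬ (y < x)

_≥_ : ℝ → ℝ → Set
x ≥ y = y ≤ x

------------------------------------------------------------------------
-- Complex numbers

record ℂ : Set where
  constructor _+i_
  field
    re im : ℝ

open ℂ public

ofℝ : ℝ → ℂ
ofℝ x = x +i 0ℝ

ℂ-rawRing : RawRing 0ℓ 0ℓ
ℂ-rawRing = record
  { Carrier = ℂ
  ; _≈_     = λ z w → (re z ≈ re w) × (im z ≈ im w)
  ; _+_     = λ z w → (re z + re w) +i (im z + im w)
  ; _*_     = λ z w → (re z * re w + - (im z * im w)) +i (re z * im w + im z * re w)
  ; -_      = λ z → (- re z) +i (- im z)
  ; 0#      = ofℝ 0#
  ; 1#      = ofℝ 1#
  }
  where open ℝ-Ring

------------------------------------------------------------------------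
-- Determinants, polynomials and characteristic polynomials

fromℕ : ∀ {c ℓ} (R : RawRing c ℓ) → ℕ → RawRing.Carrier R
fromℕ R n = n ×ᴿ 1#
  where
  open RawRing R
  open RawSemiringDefs rawSemiring using () renaming (_×_ to _×ᴿ_)

Matrix : ∀ {c} → Set c → ℕ → Set c
Matrix A n = Fin n → Fin n → A

module Determinant {c ℓ} (R : RawRing c ℓ) where
  open RawRing R
  open RawSemiringDefs rawSemiring using (sum; _^_)

  -- Laplace expansion along the first row.
  det : ∀ {n} → Matrix Carrier n → Carrier
  det {zero}  M = 1#
  det {suc n} M = sum λ j →
    (- 1#) ^ toℕ j * (M zero j * det (λ k l → M (suc k) (punchIn j l)))

module Polynomial {c ℓ} (R : RawRing c ℓ) where
  open RawRing R

  -- Coefficients are listed from the constant term upwards; trailing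
  -- zeros are immaterial because _≈ᴾ_ compares all coefficients.
  Poly : Set c
  Poly = List Carrier

  coeff : Poly → ℕ → Carrier
  coeff []      _       = 0#
  coeff (a ∷ p) zero    = a
  coeff (a ∷ p) (suc n) = coeff p n

  infix  4 _≈ᴾ_
  infixl 6 _+ᴾ_
  infixl 7 _*ᴾ_

  _≈ᴾ_ : Poly → Poly → Set ℓ
  p ≈ᴾ q = ∀ n → coeff p n ≈ coeff q n

  _+ᴾ_ : Poly → Poly → Poly
  []      +ᴾ q       = q
  (a ∷ p) +ᴾ []      = a ∷ p
  (a ∷ p) +ᴾ (b ∷ q) = (a + b) ∷ (p +ᴾ q)

  _*ᴾ_ : Poly → Poly → Poly
  []      *ᴾ q = []
  (a ∷ p) *ᴾ q = map (a *_) q +ᴾ (0# ∷ p *ᴾ q)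

  rawRing : RawRing c ℓ
  rawRing = record
    { Carrier = Poly
    ; _≈_     = _≈ᴾ_
    ; _+_     = _+ᴾ_
    ; _*_     = _*ᴾ_
    ; -_      = map (-_)
    ; 0#      = []
    ; 1#      = 1# ∷ []
    }

  X : Poly
  X = 0# ∷ 1# ∷ []

  -- For monic p: as lists the zeros of p, each repeated according to
  -- its multiplicity.
  IsMultisetOfZeros : Poly → List Carrier → Set ℓ
  IsMultisetOfZeros p as = p ≈ᴾ foldr (λ a q → (X +ᴾ (- a ∷ [])) *ᴾ q) (1# ∷ []) as

  charPoly : ∀ {n} → Matrix Carrier n → Poly
  charPoly M = det λ i j → (if does (i ≟ j) then X else []) +ᴾ (- M i j ∷ [])
    where open Determinant rawRing

------------------------------------------------------------------------
-- Finite simple graphs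

record Graph (n : ℕ) : Set where
  field
    adj        : Fin n → Fin n → Bool
    adj-sym    : ∀ u v → adj u v ≡ adj v u
    adj-irrefl : ∀ v → adj v v ≡ false

open Graph public

neighbours : ∀ {n} → Graph n → Fin n → Subset n
neighbours G v = tabulate (adj G v)

degree : ∀ {n} → Graph n → Fin n → ℕ
degree G v = ∣ neighbours G v ∣

record IsBipartition {n} (G : Graph n) (V₁ V₂ : Subset n) : Set where
  field
    cover    : ∀ v → v ∈ V₁ ⊎ v ∈ V₂
    disjoint : ∀ v → ¬ (v ∈ V₁ × v ∈ V₂)
    edges    : ∀ u v → adj G u v ≡ true → (u ∈ V₁ × v ∈ V₂) ⊎ (u ∈ V₂ × v ∈ V₁)

record IsSemiRegularBipartite {n} (G : Graph n) (V₁ V₂ : Subset n) (q₁ q₂ : ℕ) : Set where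
  field
    bipartition : IsBipartition G V₁ V₂
    degree₁     : ∀ v → v ∈ V₁ → degree G v ≡ q₁
    degree₂     : ∀ v → v ∈ V₂ → degree G v ≡ q₂

infixr 6 _∨_

_∨_ : ∀ {m n} → Graph m → Graph n → Graph (m ℕ.+ n)
_∨_ {m} {n} G H = record
  { adj        = λ u v → joinAdj (splitAt m u) (splitAt m v)
  ; adj-sym    = λ u v → joinAdj-sym (splitAt m u) (splitAt m v)
  ; adj-irrefl = λ v → joinAdj-irrefl (splitAt m v)
  }
  where
  joinAdj : Fin m ⊎ Fin n → Fin m ⊎ Fin n → Bool
  joinAdj (inj₁ u) (inj₁ v) = adj G u v
  joinAdj (inj₁ u) (inj₂ v) = true
  joinAdj (inj₂ u) (inj₁ v) = true
  joinAdj (inj₂ u) (inj₂ v) = adj H u v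

  joinAdj-sym : ∀ u v → joinAdj u v ≡ joinAdj v u
  joinAdj-sym (inj₁ u) (inj₁ v) = adj-sym G u v
  joinAdj-sym (inj₁ u) (inj₂ v) = refl
  joinAdj-sym (inj₂ u) (inj₁ v) = refl
  joinAdj-sym (inj₂ u) (inj₂ v) = adj-sym H u v

  joinAdj-irrefl : ∀ v → joinAdj v v ≡ false
  joinAdj-irrefl (inj₁ v) = adj-irrefl G v
  joinAdj-irrefl (inj₂ v) = adj-irrefl H v

adjacencyMatrix : ∀ {c ℓ} (R : RawRing c ℓ) {n} → Graph n → Matrix (RawRing.Carrier R) n
adjacencyMatrix R G u v = if adj G u v then 1# else 0#
  where open RawRing R

------------------------------------------------------------------------
-- Spectra

module ℂ-Polynomial = Polynomial ℂ-rawRing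

open ℂ-Polynomial public using (IsMultisetOfZeros)

-- The eigenvalues, with algebraic multiplicity, as complex numbers.
IsSpectrum : ∀ {n} → Graph n → List ℂ → Set
IsSpectrum G as = IsMultisetOfZeros (ℂ-Polynomial.charPoly (adjacencyMatrix ℂ-rawRing G)) as

± : List ℝ → List ℝ
± = concatMap (λ x → x ∷ ℝ-Ring.- x ∷ [])

-- x = √n
IsSqrt : ℝ → ℕ → Set
IsSqrt x n = 0ℝ ≤ x × (x * x ≈ fromℕ ℝ-rawRing n)
  where open ℝ-Ring

quartic : (q₁ q₂ q₃ q₄ ν₁ ν₂ ε₁ ε₂ : ℕ) → ℂ-Polynomial.Poly
quartic q₁ q₂ q₃ q₄ ν₁ ν₂ ε₁ ε₂ =
    (ι (q₁ ℕ.* q₂ ℕ.* q₃ ℕ.* q₄) + - ι (4 ℕ.* ε₁ ℕ.* ε₂))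
  ∷ (- ι (2 ℕ.* (ν₁ ℕ.* ε₂ ℕ.+ ν₂ ℕ.* ε₁)))
  ∷ (- ι (q₁ ℕ.* q₂ ℕ.+ q₃ ℕ.* q₄ ℕ.+ ν₁ ℕ.* ν₂))
  ∷ 0#
  ∷ 1#
  ∷ []
  where
  open RawRing ℂ-rawRing
  ι : ℕ → ℂ
  ι = fromℕ ℂ-rawRing

{-# OPTIONS --safe #-}
-- Let w be the vector x + q on each side of a semi-regular bipartite graph on ν vertices with ε
-- edges, where q is the degree on that side. Then (x I - A) w = (x² - q₁q₂) 1 and the entries of w
-- add up to ν x + 2 ε. Write (w₁ , d₁ , s₁) and (w₂ , d₂ , s₂) for the vector, the factor and the sum
-- belonging to G₁ and G₂. The characteristic matrix of the join maps (d₂ w₁ , s₁ w₂) to the vector that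
-- equals d₁d₂ - s₁s₂, the quartic f, on G₁ and 0 on G₂, so Cramer's rule gives
-- d₁ d₂ χ(G₁ ∨ G₂) = f χ(G₁) χ(G₂) up to a monic factor that cancels. Finally dᵢ = (x - λ₁)(x + λ₁)
-- (resp. μ₁) is a monic factor of χ(Gᵢ) and cancels as well.
module Submission where

open import Defs
open import Algebra.Bundles using (CommutativeRing)
open import Algebra.Bundles.Raw using (RawRing)
import Algebra.Properties.CommutativeSemigroup as CommutativeSemigroupProperties
import Algebra.Properties.Ring as RingProperties
import Algebra.Properties.Semiring.Exp as SemiringExp
import Algebra.Properties.Semiring.Mult as SemiringMult
import Algebra.Properties.Semiring.Sum as SemiringSum
import Algebra.Solver.Ring as RingSolver
open import Algebra.Solver.Ring.AlmostCommutativeRing using (AlmostCommutativeRing; fromCommutativeRing; _-Raw-AlmostCommutative⟶_)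
open import Algebra.Structures using (IsCommutativeRing)
open import Data.Bool.Base using (Bool; true; false; if_then_else_)
open import Data.Fin.Base using (Fin; zero; suc; toℕ; punchIn; punchOut; inject₁; _↑ˡ_; _↑ʳ_)
open import Data.Fin.Induction using (<-weakInduction)
import Data.Fin.Properties as Finₚ
open import Data.Fin.Subset using (Subset; ∣_∣; _∈_)
open import Data.Integer.Base as ℤ using (ℤ; +_; -[1+_]; _⊖_; _◃_)
import Data.Integer.Properties as ℤₚ
open import Data.List.Base using (List; []; _∷_; map; foldr; length; _++_; replicate)
open import Data.Maybe.Base as Maybe using (Maybe)
open import Data.Nat.Base as ℕ using (ℕ; zero; suc)
import Data.Nat.Properties as ℕₚ
open import Data.Product.Base using (∃₂; _×_; _,_; proj₁; proj₂)
open import Data.Rational.Base as ℚ using (ℚ; 0ℚ; 1ℚ; ½)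
import Data.Rational.Properties as ℚₚ
open import Data.Sign.Base as Sign using (Sign)
open import Data.Sum.Base using (_⊎_; inj₁; inj₂)
open import Data.Vec.Base using (Vec; _∷_; head; tail; toList; tabulate; lookup)
import Data.Vec.Properties as Vecₚ
open import Data.Vec.Functional using (Vector; updateAt) renaming (_∷_ to _∷ᵛ_; tail to tailᵛ; _++_ to _++ᵛ_; replicate to replicateᵛ)
open import Data.Vec.Functional.Properties using (updateAt-updates; updateAt-minimal; lookup-++ˡ; lookup-++ʳ)
open import Data.Vec.Relation.Unary.All using (All)
open import Data.Vec.Relation.Unary.Linked using (Linked)
open import Function.Base using (_∘_; const)
open import Level using (0ℓ)
open import Relation.Binary.Bundles using (Setoid)
open import Relation.Binary.Consequences using (dec⇒weaklyDec)
open import Relation.Binary.PropositionalEquality as ≡ using (_≡_; _≢_)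
import Relation.Binary.Reasoning.Setoid as SetoidReasoning
open import Relation.Binary.Structures using (IsEquivalence)
open import Relation.Nullary using (yes; no; does; contradiction)

-- Over the rational functions `w` is d (x I - A)⁻¹ 1, so s / d is the sum of all entries of (x I -
-- A)⁻¹, and the classical formula for a join reads χ(G₁) χ(G₂) (1 - s₁s₂ / (d₁d₂)). The identity of
-- the overview is this formula with denominators cleared. The shape of `w` comes from asking for
-- values a, b on the two sides with x a - q₁ b = x b - q₂ a, which a = x + q₁ and b = x + q₂
-- satisfy. Denominators are avoided because equality of Cauchy reals is undecidable: a complex
-- polynomial has no computable degree, and nonzero elements cannot be recognised in order to invert
-- them. All determinant identities are therefore proved over an arbitrary commutative ring, and the
-- only divisions are by polynomials X + a, which are monic and hence regular over any commutative
-- ring. Eigenvectors never appear; the spectra of G₁ and G₂ enter only as factorisations of their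
-- characteristic polynomials.

-- A ring solver with integer coefficients for any commutative ring

module IntegerCoefficients {c ℓ} (R : CommutativeRing c ℓ) where
  open CommutativeRing R hiding (zero)
  open RingProperties ring
  open SemiringMult semiring using (×-homo-+; ×1-homo-*) renaming (_×_ to _·_)
  open SetoidReasoning setoid

  -- The canonical homomorphism from ℤ. Equality in `R` need not be decidable, so the solver
  -- compares the coefficients of its normal forms in ℤ instead.
  ⟦_⟧ℤ : ℤ → Carrier
  ⟦ + n ⟧ℤ      = n · 1#
  ⟦ -[1+ n ] ⟧ℤ = - (suc n · 1#)

  ⟦⟧-⊖ : ∀ m n → ⟦ m ⊖ n ⟧ℤ ≈ m · 1# - n · 1#
  ⟦⟧-⊖ zero    zero    = sym (-‿inverseʳ 0#)
  ⟦⟧-⊖ zero    (suc n) = sym (+-identityˡ _)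
  ⟦⟧-⊖ (suc m) zero    = begin
    suc m · 1#         ≈⟨ +-identityʳ _ ⟨
    suc m · 1# + 0#    ≈⟨ +-congˡ -0#≈0# ⟨
    suc m · 1# - 0#    ∎
  ⟦⟧-⊖ (suc m) (suc n) = begin
    ⟦ suc m ⊖ suc n ⟧ℤ                          ≡⟨ ≡.cong ⟦_⟧ℤ (ℤₚ.[1+m]⊖[1+n]≡m⊖n m n) ⟩
    ⟦ m ⊖ n ⟧ℤ                                  ≈⟨ ⟦⟧-⊖ m n ⟩
    m · 1# - n · 1#                             ≈⟨ +-congʳ (xyx⁻¹≈y 1# (m · 1#)) ⟨
    1# + m · 1# + - 1# + - (n · 1#)             ≈⟨ +-assoc _ _ _ ⟩
    1# + m · 1# + (- 1# + - (n · 1#))           ≈⟨ +-congˡ (-‿+-comm 1# (n · 1#)) ⟩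
    (1# + m · 1#) - (1# + n · 1#)               ∎

  ⟦⟧-+ : ∀ i j → ⟦ i ℤ.+ j ⟧ℤ ≈ ⟦ i ⟧ℤ + ⟦ j ⟧ℤ
  ⟦⟧-+ (+ m)    (+ n)    = ×-homo-+ 1# m n
  ⟦⟧-+ (+ m)    -[1+ n ] = ⟦⟧-⊖ m (suc n)
  ⟦⟧-+ -[1+ m ] (+ n)    = trans (⟦⟧-⊖ n (suc m)) (+-comm _ _)
  ⟦⟧-+ -[1+ m ] -[1+ n ] = begin
    - (suc (suc (m ℕ.+ n)) · 1#)          ≡⟨ ≡.cong (λ k → - (k · 1#)) (ℕₚ.+-suc (suc m) n) ⟨
    - ((suc m ℕ.+ suc n) · 1#)            ≈⟨ -‿cong (×-homo-+ 1# (suc m) (suc n)) ⟩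
    - (suc m · 1# + suc n · 1#)           ≈⟨ -‿+-comm _ _ ⟨
    - (suc m · 1#) + - (suc n · 1#)       ∎

  ⟦⟧-neg◃ : ∀ n → ⟦ Sign.- ◃ n ⟧ℤ ≈ - (n · 1#)
  ⟦⟧-neg◃ zero    = sym -0#≈0#
  ⟦⟧-neg◃ (suc n) = refl

  ⟦⟧-pos◃ : ∀ n → ⟦ Sign.+ ◃ n ⟧ℤ ≈ n · 1#
  ⟦⟧-pos◃ n = reflexive (≡.cong ⟦_⟧ℤ (ℤₚ.+◃n≡+n n))

  ⟦⟧-* : ∀ i j → ⟦ i ℤ.* j ⟧ℤ ≈ ⟦ i ⟧ℤ * ⟦ j ⟧ℤ
  ⟦⟧-* (+ m)    (+ n)    = trans (⟦⟧-pos◃ (m ℕ.* n)) (×1-homo-* m n)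
  ⟦⟧-* (+ m)    -[1+ n ] = begin
    ⟦ Sign.- ◃ (m ℕ.* suc n) ⟧ℤ    ≈⟨ ⟦⟧-neg◃ (m ℕ.* suc n) ⟩
    - ((m ℕ.* suc n) · 1#)         ≈⟨ -‿cong (×1-homo-* m (suc n)) ⟩
    - (m · 1# * (suc n · 1#))      ≈⟨ -‿distribʳ-* _ _ ⟩
    m · 1# * - (suc n · 1#)        ∎
  ⟦⟧-* -[1+ m ] (+ n)    = begin
    ⟦ Sign.- ◃ (suc m ℕ.* n) ⟧ℤ    ≈⟨ ⟦⟧-neg◃ (suc m ℕ.* n) ⟩
    - ((suc m ℕ.* n) · 1#)         ≈⟨ -‿cong (×1-homo-* (suc m) n) ⟩
    - (suc m · 1# * (n · 1#))      ≈⟨ -‿distribˡ-* _ _ ⟩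
    - (suc m · 1#) * (n · 1#)      ∎
  ⟦⟧-* -[1+ m ] -[1+ n ] = begin
    ⟦ Sign.+ ◃ (suc m ℕ.* suc n) ⟧ℤ       ≈⟨ ⟦⟧-pos◃ (suc m ℕ.* suc n) ⟩
    (suc m ℕ.* suc n) · 1#                ≈⟨ ×1-homo-* (suc m) (suc n) ⟩
    suc m · 1# * (suc n · 1#)             ≈⟨ -‿involutive _ ⟨
    - - (suc m · 1# * (suc n · 1#))       ≈⟨ -‿cong (-‿distribˡ-* _ _) ⟩
    - (- (suc m · 1#) * (suc n · 1#))     ≈⟨ -‿distribʳ-* _ _ ⟩
    - (suc m · 1#) * - (suc n · 1#)       ∎

  ⟦⟧-neg : ∀ i → ⟦ ℤ.- i ⟧ℤ ≈ - ⟦ i ⟧ℤ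
  ⟦⟧-neg (+ zero)  = sym -0#≈0#
  ⟦⟧-neg (+ suc n) = refl
  ⟦⟧-neg -[1+ n ]  = sym (-‿involutive _)

  almostCommutativeRing : AlmostCommutativeRing c ℓ
  almostCommutativeRing = fromCommutativeRing R

  morphism : ℤ.+-*-rawRing -Raw-AlmostCommutative⟶ almostCommutativeRing
  morphism = record
    { ⟦_⟧    = ⟦_⟧ℤ
    ; +-homo = ⟦⟧-+
    ; *-homo = ⟦⟧-*
    ; -‿homo = ⟦⟧-neg
    ; 0-homo = refl
    ; 1-homo = +-identityʳ 1#
    }

  ⟦⟧-weaklyDecidable : ∀ i j → Maybe (⟦ i ⟧ℤ ≈ ⟦ j ⟧ℤ)
  ⟦⟧-weaklyDecidable i j = Maybe.map (reflexive ∘ ≡.cong ⟦_⟧ℤ) (dec⇒weaklyDec ℤₚ._≟_ i j)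

  open RingSolver ℤ.+-*-rawRing almostCommutativeRing morphism ⟦⟧-weaklyDecidable public
    using (solve; _:=_; _:+_; _:*_; :-_; con)

-- Determinants: linearity and alternation in the columns

module DeterminantProperties {c ℓ} (R : CommutativeRing c ℓ) where
  open CommutativeRing R hiding (zero)
  open Determinant rawRing
  open IntegerCoefficients R
  open RingProperties ring using (-1*x≈-x)
  open SemiringSum semiring
  open SetoidReasoning setoid
  open SemiringExp semiring using (_^_)

  Column : ℕ → Set c
  Column n = Fin n → Carrier

  minor : ∀ {n} → Matrix Carrier (suc n) → Fin (suc n) → Matrix Carrier n
  minor M j k l = M (suc k) (punchIn j l)

  sign : ∀ {n} → Fin n → Carrier
  sign j = (- 1#) ^ toℕ j

  laplaceTerm : ∀ {n} → Matrix Carrier (suc n) → Fin (suc n) → Carrier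
  laplaceTerm M j = sign j * (M zero j * det (minor M j))

  infixl 10 _[_]≔_

  _[_]≔_ : ∀ {n} → Matrix Carrier n → Fin n → Column n → Matrix Carrier n
  (M [ j ]≔ v) i = updateAt (M i) j (const (v i))

  sum-zero : ∀ {n} (t : Vector Carrier n) → (∀ i → t i ≈ 0#) → sum t ≈ 0#
  sum-zero {n} t t≈0 = trans (sum-cong-≋ t≈0) (sum-replicate-zero n)

  sum-linear : ∀ {n} a b (s t : Vector Carrier n) →
               sum (λ i → a * s i + b * t i) ≈ a * sum s + b * sum t
  sum-linear a b s t = begin
    sum (λ i → a * s i + b * t i)                   ≈⟨ ∑-distrib-+ (λ i → a * s i) (λ i → b * t i) ⟩
    sum (λ i → a * s i) + sum (λ i → b * t i)       ≈⟨ +-cong (*-distribˡ-sum a s) (*-distribˡ-sum b t) ⟨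
    a * sum s + b * sum t                           ∎

  sum-↑ : ∀ m {n} (t : Vector Carrier (m ℕ.+ n)) →
          sum t ≈ sum (λ i → t (i ↑ˡ n)) + sum (λ j → t (m ↑ʳ j))
  sum-↑ zero    t = sym (+-identityˡ _)
  sum-↑ (suc m) t = trans (+-congˡ (sum-↑ m (t ∘ suc))) (sym (+-assoc _ _ _))

  det-cong : ∀ {n} {M N : Matrix Carrier n} → (∀ i j → M i j ≈ N i j) → det M ≈ det N
  det-cong {zero}          M≈N = refl
  det-cong {suc n} {M} {N} M≈N = sum-cong-≋ {_} {laplaceTerm M} {laplaceTerm N} λ j →
    *-congˡ {sign j} (*-cong (M≈N zero j) (det-cong λ k l → M≈N (suc k) (punchIn j l)))

  -- In the Laplace term of column `j` the entry carries the combination and the minors agree; in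
  -- every other term the entry is common and the minor is linear in what is left of column `j`.
  -- Three matrices that agree off `j`, rather than updates of a single one, let the induction
  -- hypothesis apply directly to minors.
  det-linear : ∀ {n} (j : Fin n) a b (L M N : Matrix Carrier n) →
               (∀ i k → k ≢ j → L i k ≈ M i k) → (∀ i k → k ≢ j → L i k ≈ N i k) →
               (∀ i → L i j ≈ a * M i j + b * N i j) →
               det L ≈ a * det M + b * det N
  det-linear {suc n} j a b L M N L≈M L≈N Lⱼ =
    trans (sum-cong-≋ {_} {laplaceTerm L} {λ k → a * laplaceTerm M k + b * laplaceTerm N k} term-linear)
          (sum-linear a b (laplaceTerm M) (laplaceTerm N))
    where
    term-linear : ∀ k → laplaceTerm L k ≈ a * laplaceTerm M k + b * laplaceTerm N k
    term-linear k with k Finₚ.≟ j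
    ... | yes ≡.refl = begin
      sign k * (L zero k * det (minor L k))
        ≈⟨ *-congˡ (*-congʳ (Lⱼ zero)) ⟩
      sign k * ((a * M zero k + b * N zero k) * det (minor L k))
        ≈⟨ solve 6 (λ s a b m n d → s :* ((a :* m :+ b :* n) :* d) := a :* (s :* (m :* d)) :+ b :* (s :* (n :* d)))
                 refl (sign k) a b (M zero k) (N zero k) (det (minor L k)) ⟩
      a * (sign k * (M zero k * det (minor L k))) + b * (sign k * (N zero k * det (minor L k)))
        ≈⟨ +-cong (*-congˡ (*-congˡ (*-congˡ (det-cong λ i l → L≈M (suc i) _ (Finₚ.punchInᵢ≢i k l)))))
                  (*-congˡ (*-congˡ (*-congˡ (det-cong λ i l → L≈N (suc i) _ (Finₚ.punchInᵢ≢i k l))))) ⟩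
      a * laplaceTerm M k + b * laplaceTerm N k ∎
    ... | no k≢j = begin
      sign k * (L zero k * det (minor L k))
        ≈⟨ *-congˡ (*-congˡ (det-linear j′ a b (minor L k) (minor M k) (minor N k)
             (λ i l l≢j′ → L≈M (suc i) _ (off l≢j′)) (λ i l l≢j′ → L≈N (suc i) _ (off l≢j′))
             (λ i → ≡.subst (λ l → L (suc i) l ≈ a * M (suc i) l + b * N (suc i) l) (≡.sym at) (Lⱼ (suc i))))) ⟩
      sign k * (L zero k * (a * det (minor M k) + b * det (minor N k)))
        ≈⟨ solve 6 (λ s x a b m n → s :* (x :* (a :* m :+ b :* n)) := a :* (s :* (x :* m)) :+ b :* (s :* (x :* n)))
                 refl (sign k) (L zero k) a b (det (minor M k)) (det (minor N k)) ⟩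
      a * (sign k * (L zero k * det (minor M k))) + b * (sign k * (L zero k * det (minor N k)))
        ≈⟨ +-cong (*-congˡ (*-congˡ (*-congʳ (L≈M zero k k≢j)))) (*-congˡ (*-congˡ (*-congʳ (L≈N zero k k≢j)))) ⟩
      a * laplaceTerm M k + b * laplaceTerm N k ∎
      where
      j′ = punchOut k≢j
      at : punchIn k j′ ≡ j
      at = Finₚ.punchIn-punchOut k≢j
      off : ∀ {l} → l ≢ j′ → punchIn k l ≢ j
      off l≢j′ eq = l≢j′ (Finₚ.punchIn-injective k _ _ (≡.trans eq (≡.sym at)))

  det-zero-column : ∀ {n} (j : Fin n) (M : Matrix Carrier n) → (∀ i → M i j ≈ 0#) → det M ≈ 0#
  det-zero-column j M Mⱼ≈0 = begin
    det M                        ≈⟨ det-linear j 0# 0# M M M (λ _ _ _ → refl) (λ _ _ _ → refl)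
                                      (λ i → trans (Mⱼ≈0 i) (sym (vanish (M i j)))) ⟩
    0# * det M + 0# * det M      ≈⟨ vanish (det M) ⟩
    0#                           ∎
    where
    vanish : ∀ x → 0# * x + 0# * x ≈ 0#
    vanish x = trans (+-cong (zeroˡ x) (zeroˡ x)) (+-identityˡ 0#)

  -- An inductive form of `toℕ b ≡ suc (toℕ a)`, suited to recursion alongside `punchIn`.
  data Adjacent : ∀ {n} → Fin n → Fin n → Set where
    here  : ∀ {n} → Adjacent {suc (suc n)} zero (suc zero)
    there : ∀ {n} {a b : Fin n} → Adjacent a b → Adjacent (suc a) (suc b)

  adjacent-inject₁ : ∀ {n} (i : Fin n) → Adjacent (inject₁ i) (suc i)
  adjacent-inject₁ zero    = here
  adjacent-inject₁ (suc i) = there (adjacent-inject₁ i)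

  adjacent⇒≢ : ∀ {n} {a b : Fin n} → Adjacent a b → a ≢ b
  adjacent⇒≢ (there ab) eq = adjacent⇒≢ ab (Finₚ.suc-injective eq)

  adjacent-toℕ : ∀ {n} {a b : Fin n} → Adjacent a b → toℕ b ≡ suc (toℕ a)
  adjacent-toℕ here       = ≡.refl
  adjacent-toℕ (there ab) = ≡.cong suc (adjacent-toℕ ab)

  -- Serves to show that, when columns `a` and `b` are equal, deleting either leaves the same minor:
  -- the survivors differ in one place only, where one minor has `b` and the other `a`.
  punchIn-adjacent : ∀ {n} {a b : Fin (suc n)} → Adjacent a b → ∀ l →
                     punchIn a l ≡ punchIn b l ⊎ (punchIn a l ≡ b × punchIn b l ≡ a)
  punchIn-adjacent here       zero    = inj₂ (≡.refl , ≡.refl)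
  punchIn-adjacent here       (suc l) = inj₁ ≡.refl
  punchIn-adjacent (there ab) zero    = inj₁ ≡.refl
  punchIn-adjacent {suc n} (there ab) (suc l) with punchIn-adjacent ab l
  ... | inj₁ eq        = inj₁ (≡.cong suc eq)
  ... | inj₂ (eq , eq′) = inj₂ (≡.cong suc eq , ≡.cong suc eq′)

  -- No third column lies between `a` and `b`, so they stay neighbours in the minor; this feeds the
  -- recursion of `det-adjacent`.
  adjacent-punchOut : ∀ {n} {a b : Fin (suc n)} → Adjacent a b → ∀ k → k ≢ a → k ≢ b →
                      ∃₂ λ a′ b′ → Adjacent a′ b′ × punchIn k a′ ≡ a × punchIn k b′ ≡ b
  adjacent-punchOut here zero                k≢a k≢b = contradiction ≡.refl k≢a
  adjacent-punchOut here (suc zero)          k≢a k≢b = contradiction ≡.refl k≢b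
  adjacent-punchOut {suc (suc n)} here (suc (suc k)) k≢a k≢b = zero , suc zero , here , ≡.refl , ≡.refl
  adjacent-punchOut (there ab) zero          k≢a k≢b = _ , _ , ab , ≡.refl , ≡.refl
  adjacent-punchOut {suc n} (there ab) (suc k) k≢a k≢b
    with adjacent-punchOut ab k (k≢a ∘ ≡.cong suc) (k≢b ∘ ≡.cong suc)
  ... | a′ , b′ , ab′ , eq , eq′ = suc a′ , suc b′ , there ab′ , ≡.cong suc eq , ≡.cong suc eq′

  sum-adjacent : ∀ {n} {a b : Fin n} → Adjacent a b → (t : Vector Carrier n) →
                 (∀ k → k ≢ a → k ≢ b → t k ≈ 0#) → t a + t b ≈ 0# → sum t ≈ 0#
  sum-adjacent here t t≈0 ta+tb≈0 = begin
    t zero + (t (suc zero) + sum (λ k → t (suc (suc k))))    ≈⟨ +-assoc _ _ _ ⟨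
    t zero + t (suc zero) + sum (λ k → t (suc (suc k)))      ≈⟨ +-cong ta+tb≈0 (sum-zero _ λ k → t≈0 (suc (suc k)) (λ ()) (λ ())) ⟩
    0# + 0#                                                  ≈⟨ +-identityˡ 0# ⟩
    0#                                                       ∎
  sum-adjacent (there ab) t t≈0 ta+tb≈0 = trans
    (+-cong (t≈0 zero (λ ()) (λ ()))
            (sum-adjacent ab (t ∘ suc) (λ k k≢a k≢b → t≈0 (suc k) (k≢a ∘ Finₚ.suc-injective) (k≢b ∘ Finₚ.suc-injective)) ta+tb≈0))
    (+-identityˡ 0#)

  -- The minors of all columns other than `a` and `b` still contain two equal neighbours and vanish
  -- by induction. The two terms left have equal entries and equal minors, and opposite signs
  -- because the positions differ by one.
  det-adjacent : ∀ {n} {a b : Fin n} → Adjacent a b → (M : Matrix Carrier n) →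
                 (∀ i → M i a ≈ M i b) → det M ≈ 0#
  det-adjacent {suc n} {a} {b} ab M Mₐ≈M_b = sum-adjacent ab (laplaceTerm M) vanish cancel
    where
    vanish : ∀ k → k ≢ a → k ≢ b → laplaceTerm M k ≈ 0#
    vanish k k≢a k≢b with adjacent-punchOut ab k k≢a k≢b
    ... | a′ , b′ , ab′ , eq , eq′ = begin
      sign k * (M zero k * det (minor M k))
        ≈⟨ *-congˡ (*-congˡ (det-adjacent ab′ (minor M k) λ i →
             trans (reflexive (≡.cong (M (suc i)) eq)) (trans (Mₐ≈M_b (suc i)) (reflexive (≡.cong (M (suc i)) (≡.sym eq′)))))) ⟩
      sign k * (M zero k * 0#)    ≈⟨ *-congˡ (zeroʳ _) ⟩
      sign k * 0#                 ≈⟨ zeroʳ _ ⟩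
      0#                          ∎

    minors : ∀ i l → minor M b i l ≈ minor M a i l
    minors i l with punchIn-adjacent ab l
    ... | inj₁ eq         = reflexive (≡.cong (M (suc i)) (≡.sym eq))
    ... | inj₂ (eq , eq′) = trans (reflexive (≡.cong (M (suc i)) eq′))
                              (trans (Mₐ≈M_b (suc i)) (reflexive (≡.cong (M (suc i)) (≡.sym eq))))

    cancel : laplaceTerm M a + laplaceTerm M b ≈ 0#
    cancel = begin
      laplaceTerm M a + sign b * (M zero b * det (minor M b))
        ≈⟨ +-congˡ (*-cong (reflexive (≡.cong ((- 1#) ^_) (adjacent-toℕ ab)))
             (*-cong (sym (Mₐ≈M_b zero)) (det-cong minors))) ⟩
      laplaceTerm M a + (- 1# * sign a) * (M zero a * det (minor M a))
        ≈⟨ +-congˡ (trans (*-assoc _ _ _) (-1*x≈-x _)) ⟩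
      laplaceTerm M a - laplaceTerm M a
        ≈⟨ -‿inverseʳ _ ⟩
      0# ∎

  at : ∀ {n} (M : Matrix Carrier n) j v i → (M [ j ]≔ v) i j ≈ v i
  at M j v i = reflexive (updateAt-updates j (M i))

  off : ∀ {n} (M : Matrix Carrier n) j v i k → k ≢ j → (M [ j ]≔ v) i k ≈ M i k
  off M j v i k k≢j = reflexive (updateAt-minimal k j (M i) k≢j)

  -- Moves the repeated column leftwards: with u = M₀ = M_b and v = Mₐ, expanding the
  -- vanishing determinant with u + v in both columns a and b leaves only det M.
  det-alternating : ∀ {n} (k : Fin (suc n)) → zero ≢ k → (M : Matrix Carrier (suc n)) →
                    (∀ i → M i zero ≈ M i k) → det M ≈ 0#
  det-alternating {n} = <-weakInduction P (contradiction ≡.refl) step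
    where
    P : Fin (suc n) → Set _
    P k = zero ≢ k → (M : Matrix Carrier (suc n)) → (∀ i → M i zero ≈ M i k) → det M ≈ 0#

    step : ∀ i → P (inject₁ i) → P (suc i)
    step zero    _  _ M M₀≈M₁ = det-adjacent here M M₀≈M₁
    step (suc i) Pₐ _ M M₀≈M_b = begin
      det M                                  ≈⟨ +-identityʳ _ ⟨
      det M + 0#                             ≈⟨ +-cong (*-identityˡ _) (trans (*-identityˡ _) both-v) ⟨
      1# * det M + 1# * det (M [ b ]≔ v)     ≈⟨ det-linear b 1# 1# (M [ b ]≔ u+v) M (M [ b ]≔ v)
                                                  (λ i k → off M b u+v i k)
                                                  (λ i k k≢b → trans (off M b u+v i k k≢b) (sym (off M b v i k k≢b)))
                                                  (λ i → trans (at M b u+v i) (+-cong (trans (M₀≈M_b i) (sym (*-identityˡ _)))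
                                                           (trans (sym (at M b v i)) (sym (*-identityˡ _))))) ⟨
      det N                                  ≈⟨ +-identityˡ _ ⟨
      0# + det N                             ≈⟨ +-cong (trans (*-identityˡ _) u-twice) (*-identityˡ _) ⟨
      1# * det (N [ a ]≔ u) + 1# * det N     ≈⟨ det-linear a 1# 1# (N [ a ]≔ u+v) (N [ a ]≔ u) N
                                                  (λ i k k≢a → trans (off N a u+v i k k≢a) (sym (off N a u i k k≢a)))
                                                  (λ i k → off N a u+v i k)
                                                  (λ i → trans (at N a u+v i) (+-cong (trans (sym (at N a u i)) (sym (*-identityˡ _)))
                                                           (trans (sym (off M b u+v i a a≢b)) (sym (*-identityˡ _))))) ⟨
      det (N [ a ]≔ u+v)                     ≈⟨ det-adjacent ab (N [ a ]≔ u+v) (λ i → trans (at N a u+v i)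
                                                  (sym (trans (off N a u+v i b (a≢b ∘ ≡.sym)) (at M b u+v i)))) ⟩
      0#                                     ∎
      where
      a b : Fin (suc n)
      a = inject₁ (suc i)
      b = suc (suc i)
      ab : Adjacent a b
      ab = adjacent-inject₁ (suc i)
      a≢b : a ≢ b
      a≢b = adjacent⇒≢ ab
      u v u+v : Column (suc n)
      u i = M i zero
      v i = M i a
      u+v i = u i + v i
      N : Matrix Carrier (suc n)
      N = M [ b ]≔ u+v
      both-v : det (M [ b ]≔ v) ≈ 0#
      both-v = det-adjacent ab (M [ b ]≔ v) (λ i → trans (off M b v i a a≢b) (sym (at M b v i)))
      u-twice : det (N [ a ]≔ u) ≈ 0#
      u-twice = Pₐ (λ ()) (N [ a ]≔ u) (λ i → trans (off N a u i zero (λ ()))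
                  (trans (off M b u+v i zero (λ ())) (sym (at N a u i))))

  -- Cramer's rule for the first column, column operations and block triangular matrices

  det-first-column-sum : ∀ {m n} (M : Matrix Carrier (suc n)) (w : Vector Carrier m) (u : Fin m → Column (suc n)) →
    det (M [ zero ]≔ (λ i → sum (λ k → w k * u k i))) ≈ sum (λ k → w k * det (M [ zero ]≔ u k))
  det-first-column-sum {zero}  M w u = det-zero-column zero (M [ zero ]≔ (λ _ → 0#)) (λ _ → refl)
  det-first-column-sum {suc m} M w u = begin
    det (M [ zero ]≔ (λ i → sum (λ k → w k * u k i)))
      ≈⟨ det-linear zero (w zero) 1# _ (M [ zero ]≔ u zero) (M [ zero ]≔ rest)
           agree agree (λ i → +-congˡ (sym (*-identityˡ _))) ⟩
    w zero * det (M [ zero ]≔ u zero) + 1# * det (M [ zero ]≔ rest)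
      ≈⟨ +-congˡ (trans (*-identityˡ _) (det-first-column-sum M (w ∘ suc) (u ∘ suc))) ⟩
    sum (λ k → w k * det (M [ zero ]≔ u k)) ∎
    where
    rest : Column _
    rest i = sum (λ k → w (suc k) * u (suc k) i)
    agree : ∀ {v v′} i k → k ≢ zero → (M [ zero ]≔ v) i k ≈ (M [ zero ]≔ v′) i k
    agree i zero    k≢0 = contradiction ≡.refl k≢0
    agree i (suc k) _   = refl

  -- By linearity in the first column: every summand but the one of column zero repeats a later
  -- column and vanishes. Here and in `det-shear` one of the equal columns is always column zero,
  -- hence the form of `det-alternating`.
  det-cramer : ∀ {n} (M : Matrix Carrier (suc n)) (w : Vector Carrier (suc n)) →
               det (M [ zero ]≔ (λ i → sum (λ k → w k * M i k))) ≈ w zero * det M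
  det-cramer M w = begin
    det (M [ zero ]≔ (λ i → sum (λ k → w k * M i k)))
      ≈⟨ det-first-column-sum M w (λ k i → M i k) ⟩
    w zero * det (M [ zero ]≔ (λ i → M i zero)) + sum (λ k → w (suc k) * det (M [ zero ]≔ (λ i → M i (suc k))))
      ≈⟨ +-cong (*-congˡ (det-cong unchanged)) (sum-zero _ λ k →
           trans (*-congˡ (det-alternating (suc k) (λ ()) (M [ zero ]≔ (λ i → M i (suc k))) (λ _ → refl))) (zeroʳ _)) ⟩
    w zero * det M + 0#
      ≈⟨ +-identityʳ _ ⟩
    w zero * det M ∎
    where
    unchanged : ∀ i k → (M [ zero ]≔ (λ i → M i zero)) i k ≈ M i k
    unchanged i zero    = refl
    unchanged i (suc k) = refl

  -- Passes from changing one coordinate at a time to changing all of them. The assumption that `F`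
  -- respects pointwise equality takes the place of function extensionality.
  update-invariant⇒constant : ∀ {a} {A : Set a} {n} (F : Vector A n → Carrier) →
    (∀ {s t} → (∀ i → s i ≡ t i) → F s ≈ F t) →
    (∀ s k x → F (updateAt s k (const x)) ≈ F s) → ∀ s t → F s ≈ F t
  update-invariant⇒constant {n = zero}  F F-cong F-update s t = F-cong λ ()
  update-invariant⇒constant {n = suc n} F F-cong F-update s t = begin
    F s                                  ≈⟨ F-update s zero (t zero) ⟨
    F (updateAt s zero (const (t zero))) ≈⟨ F-cong (λ { zero → ≡.refl ; (suc i) → ≡.refl }) ⟩
    F (t zero ∷ᵛ tailᵛ s)                ≈⟨ update-invariant⇒constant (λ r → F (t zero ∷ᵛ r))
                                              (λ eq → F-cong λ { zero → ≡.refl ; (suc i) → eq i })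
                                              (λ r k x → trans (F-cong (λ { zero → ≡.refl ; (suc i) → ≡.refl }))
                                                               (F-update (t zero ∷ᵛ r) (suc k) x))
                                              (tailᵛ s) (tailᵛ t) ⟩
    F (t zero ∷ᵛ tailᵛ t)                ≈⟨ F-cong (λ { zero → ≡.refl ; (suc i) → ≡.refl }) ⟩
    F t                                  ∎

  shear : ∀ {n} → Matrix Carrier (suc n) → Vector Carrier n → Matrix Carrier (suc n)
  shear M c i zero    = M i zero
  shear M c i (suc k) = M i (suc k) + c k * M i zero

  -- Changing a single `c k` adds a multiple of a determinant whose columns zero and `suc k`
  -- coincide. The determinant is thus independent of `c` and may be evaluated at zero.
  det-shear : ∀ {n} (M : Matrix Carrier (suc n)) (c : Vector Carrier n) → det (shear M c) ≈ det M
  det-shear {n} M c = trans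
    (update-invariant⇒constant (det ∘ shear M) cong update c (const 0#))
    (det-cong {M = shear M (const 0#)} {M} λ { i zero → refl ; i (suc k) → trans (+-congˡ (zeroˡ _)) (+-identityʳ _) })
    where
    cong : ∀ {s t} → (∀ i → s i ≡ t i) → det (shear M s) ≈ det (shear M t)
    cong {s} {t} s≡t = det-cong {M = shear M s} {shear M t} λ { i zero → refl ; i (suc k) → +-congˡ (*-congʳ (reflexive (s≡t k))) }

    update : ∀ s k x → det (shear M (updateAt s k (const x))) ≈ det (shear M s)
    update s k x = begin
      det (shear M (updateAt s k (const x)))
        ≈⟨ det-linear (suc k) 1# (x - s k) _ (shear M s) N agree
             (λ i l l≢k → trans (agree i l l≢k) (sym (off (shear M s) (suc k) (λ i → M i zero) i l l≢k)))
             column ⟩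
      1# * det (shear M s) + (x - s k) * det N
        ≈⟨ +-cong (*-identityˡ _) (trans (*-congˡ (det-alternating (suc k) (λ ()) N
             (λ i → sym (at (shear M s) (suc k) (λ i → M i zero) i)))) (zeroʳ _)) ⟩
      det (shear M s) + 0#
        ≈⟨ +-identityʳ _ ⟩
      det (shear M s) ∎
      where
      N : Matrix Carrier (suc n)
      N = shear M s [ suc k ]≔ (λ i → M i zero)
      agree : ∀ i l → l ≢ suc k → shear M (updateAt s k (const x)) i l ≈ shear M s i l
      agree i zero    _   = refl
      agree i (suc l) l≢k = +-congˡ (*-congʳ (reflexive (updateAt-minimal l k s (l≢k ∘ ≡.cong suc))))
      column : ∀ i → shear M (updateAt s k (const x)) i (suc k) ≈ 1# * shear M s i (suc k) + (x - s k) * N i (suc k)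
      column i = begin
        M i (suc k) + updateAt s k (const x) k * M i zero
          ≈⟨ +-congˡ (*-congʳ (reflexive (updateAt-updates k s))) ⟩
        M i (suc k) + x * M i zero
          ≈⟨ solve 4 (λ m x s z → m :+ x :* z := con (+ 1) :* (m :+ s :* z) :+ (x :+ :- s) :* z)
                   refl (M i (suc k)) x (s k) (M i zero) ⟩
        ⟦ + 1 ⟧ℤ * shear M s i (suc k) + (x - s k) * M i zero
          ≈⟨ +-cong (*-congʳ (+-identityʳ 1#)) (*-congˡ (sym (at (shear M s) (suc k) (λ i → M i zero) i))) ⟩
        1# * shear M s i (suc k) + (x - s k) * N i (suc k) ∎

  punchIn-↑ˡ-↑ˡ : ∀ {m} n (j : Fin (suc m)) (l : Fin m) → punchIn (j ↑ˡ n) (l ↑ˡ n) ≡ punchIn j l ↑ˡ n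
  punchIn-↑ˡ-↑ˡ n zero    l       = ≡.refl
  punchIn-↑ˡ-↑ˡ n (suc j) zero    = ≡.refl
  punchIn-↑ˡ-↑ˡ n (suc j) (suc l) = ≡.cong suc (punchIn-↑ˡ-↑ˡ n j l)

  punchIn-↑ˡ-↑ʳ : ∀ m n (j : Fin (suc m)) (l : Fin n) → punchIn (j ↑ˡ n) (m ↑ʳ l) ≡ suc (m ↑ʳ l)
  punchIn-↑ˡ-↑ʳ m       n zero    l = ≡.refl
  punchIn-↑ˡ-↑ʳ (suc m) n (suc j) l = ≡.cong suc (punchIn-↑ˡ-↑ʳ m n j l)

  -- In the expansion along the first row the right-hand columns contribute zero entries, and the
  -- minor of a left-hand column is again block triangular with the same lower right block.
  det-block-triangular : ∀ m {n} (M : Matrix Carrier (m ℕ.+ n)) → (∀ i j → M (i ↑ˡ n) (m ↑ʳ j) ≈ 0#) →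
    det M ≈ det (λ i j → M (i ↑ˡ n) (j ↑ˡ n)) * det (λ i j → M (m ↑ʳ i) (m ↑ʳ j))
  det-block-triangular zero        M _     = sym (*-identityˡ _)
  det-block-triangular (suc m) {n} M upper = begin
    det M
      ≈⟨ sum-↑ (suc m) (laplaceTerm M) ⟩
    sum (λ j → laplaceTerm M (j ↑ˡ n)) + sum (λ j → laplaceTerm M (suc (m ↑ʳ j)))
      ≈⟨ +-cong (sum-cong-≋ {_} {λ j → laplaceTerm M (j ↑ˡ n)} {λ j → laplaceTerm A j * det D} left) (sum-zero _ right) ⟩
    sum (λ j → laplaceTerm A j * det D) + 0#
      ≈⟨ +-identityʳ _ ⟩
    sum (λ j → laplaceTerm A j * det D)
      ≈⟨ *-distribʳ-sum (det D) (laplaceTerm A) ⟨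
    det A * det D ∎
    where
    A : Matrix Carrier (suc m)
    A i j = M (i ↑ˡ n) (j ↑ˡ n)
    D : Matrix Carrier n
    D i j = M (suc (m ↑ʳ i)) (suc (m ↑ʳ j))

    right : ∀ j → laplaceTerm M (suc (m ↑ʳ j)) ≈ 0#
    right j = trans (*-congˡ (trans (*-congʳ (upper zero j)) (zeroˡ _))) (zeroʳ _)

    left : ∀ j → laplaceTerm M (j ↑ˡ n) ≈ laplaceTerm A j * det D
    left j = begin
      sign (j ↑ˡ n) * (A zero j * det (minor M (j ↑ˡ n)))
        ≈⟨ *-cong (reflexive (≡.cong ((- 1#) ^_) (Finₚ.toℕ-↑ˡ j n)))
             (*-congˡ (det-block-triangular m (minor M (j ↑ˡ n)) λ i l →
               trans (entry (i ↑ˡ n) (punchIn-↑ˡ-↑ʳ m n j l)) (upper (suc i) l))) ⟩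
      sign j * (A zero j * (det (λ k l → minor M (j ↑ˡ n) (k ↑ˡ n) (l ↑ˡ n)) * det (λ k l → minor M (j ↑ˡ n) (m ↑ʳ k) (m ↑ʳ l))))
        ≈⟨ *-congˡ (*-congˡ (*-cong (det-cong λ k l → entry (k ↑ˡ n) (punchIn-↑ˡ-↑ˡ n j l))
                                    (det-cong λ k l → entry (m ↑ʳ k) (punchIn-↑ˡ-↑ʳ m n j l)))) ⟩
      sign j * (A zero j * (det (minor A j) * det D))
        ≈⟨ *-congˡ (*-assoc _ _ _) ⟨
      sign j * (A zero j * det (minor A j) * det D)
        ≈⟨ *-assoc _ _ _ ⟨
      laplaceTerm A j * det D ∎
      where
      entry : ∀ i {k l} → k ≡ l → M (suc i) k ≈ M (suc i) l
      entry i eq = reflexive (≡.cong (M (suc i)) eq)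

-- Block structure of the vertices and adjacencies of a join

↑-elim : ∀ {p} m {n} (P : Fin (m ℕ.+ n) → Set p) →
         (∀ i → P (i ↑ˡ n)) → (∀ j → P (m ↑ʳ j)) → ∀ k → P k
↑-elim zero    P left right k       = right k
↑-elim (suc m) P left right zero    = left zero
↑-elim (suc m) P left right (suc k) = ↑-elim m (P ∘ suc) (left ∘ suc) right k

does-≟-↑ˡ-↑ˡ : ∀ {m} n (i j : Fin m) → does (i ↑ˡ n Finₚ.≟ j ↑ˡ n) ≡ does (i Finₚ.≟ j)
does-≟-↑ˡ-↑ˡ n zero    zero    = ≡.refl
does-≟-↑ˡ-↑ˡ n zero    (suc j) = ≡.refl
does-≟-↑ˡ-↑ˡ n (suc i) zero    = ≡.refl
does-≟-↑ˡ-↑ˡ n (suc i) (suc j) = does-≟-↑ˡ-↑ˡ n i j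

does-≟-↑ʳ-↑ʳ : ∀ m {n} (i j : Fin n) → does (m ↑ʳ i Finₚ.≟ m ↑ʳ j) ≡ does (i Finₚ.≟ j)
does-≟-↑ʳ-↑ʳ zero    i j = ≡.refl
does-≟-↑ʳ-↑ʳ (suc m) i j = does-≟-↑ʳ-↑ʳ m i j

does-≟-↑ˡ-↑ʳ : ∀ m n (i : Fin m) (j : Fin n) → does (i ↑ˡ n Finₚ.≟ m ↑ʳ j) ≡ false
does-≟-↑ˡ-↑ʳ (suc m) n zero    j = ≡.refl
does-≟-↑ˡ-↑ʳ (suc m) n (suc i) j = does-≟-↑ˡ-↑ʳ m n i j

does-≟-↑ʳ-↑ˡ : ∀ m n (i : Fin n) (j : Fin m) → does (m ↑ʳ i Finₚ.≟ j ↑ˡ n) ≡ false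
does-≟-↑ʳ-↑ˡ (suc m) n i zero    = ≡.refl
does-≟-↑ʳ-↑ˡ (suc m) n i (suc j) = does-≟-↑ʳ-↑ˡ m n i j

module _ {m n} (G : Graph m) (H : Graph n) where

  adj-∨-ˡˡ : ∀ i j → adj (G ∨ H) (i ↑ˡ n) (j ↑ˡ n) ≡ adj G i j
  adj-∨-ˡˡ i j rewrite Finₚ.splitAt-↑ˡ m i n | Finₚ.splitAt-↑ˡ m j n = ≡.refl

  adj-∨-ˡʳ : ∀ i j → adj (G ∨ H) (i ↑ˡ n) (m ↑ʳ j) ≡ true
  adj-∨-ˡʳ i j rewrite Finₚ.splitAt-↑ˡ m i n | Finₚ.splitAt-↑ʳ m n j = ≡.refl

  adj-∨-ʳˡ : ∀ i j → adj (G ∨ H) (m ↑ʳ i) (j ↑ˡ n) ≡ true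
  adj-∨-ʳˡ i j rewrite Finₚ.splitAt-↑ʳ m n i | Finₚ.splitAt-↑ˡ m j n = ≡.refl

  adj-∨-ʳʳ : ∀ i j → adj (G ∨ H) (m ↑ʳ i) (m ↑ʳ j) ≡ adj H i j
  adj-∨-ʳʳ i j rewrite Finₚ.splitAt-↑ʳ m n i | Finₚ.splitAt-↑ʳ m n j = ≡.refl

-- The characteristic determinant of a join over a commutative ring

module JoinDeterminant {c ℓ} (R : CommutativeRing c ℓ) where
  open CommutativeRing R hiding (zero)
  open Determinant rawRing
  open DeterminantProperties R
  open IntegerCoefficients R
  open RingProperties ring using (-1*x≈-x; -0#≈0#; -‿distribʳ-*)
  open SemiringMult semiring using (×-homo-+; ×1-homo-*; ×-assoc-*; ×-congʳ) renaming (_×_ to _·_)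
  open SemiringSum semiring
  open SetoidReasoning setoid

  -- Regularity of an element. Nothing is assumed about zero divisors of `R`, so each division has
  -- to name a regular element.
  Cancellative : Carrier → Set _
  Cancellative a = ∀ {u v} → a * u ≈ a * v → u ≈ v

  sum-*ˡ : ∀ {n} a (s t : Vector Carrier n) → sum (λ i → a * s i * t i) ≈ a * sum (λ i → s i * t i)
  sum-*ˡ a s t = trans (sum-cong-≋ λ i → *-assoc a (s i) (t i)) (sym (*-distribˡ-sum a λ i → s i * t i))

  module _ {n} (M₂ : Matrix Carrier n) (w₂ : Vector Carrier n) (d₂ : Carrier)
           (M₂w₂ : ∀ i → sum (λ j → w₂ j * M₂ i j) ≈ d₂) where

    -- The vector (d₂ w₁ , (Σ w₁) w₂) is mapped to d₁d₂ - (Σ w₁)(Σ w₂) on the first block and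
    -- to 0 on the second; Cramer's rule for the first column then makes the matrix block triangular.
    det-join-nonempty : ∀ {m} (M₁ : Matrix Carrier (suc m)) (w₁ : Vector Carrier (suc m)) (d₁ : Carrier) →
      (∀ i → sum (λ j → w₁ j * M₁ i j) ≈ d₁) →
      (M : Matrix Carrier (suc m ℕ.+ n)) →
      (∀ i j → M (i ↑ˡ n) (j ↑ˡ n) ≈ M₁ i j) → (∀ i j → M (i ↑ˡ n) (suc m ↑ʳ j) ≈ - 1#) →
      (∀ i j → M (suc m ↑ʳ i) (j ↑ˡ n) ≈ - 1#) → (∀ i j → M (suc m ↑ʳ i) (suc m ↑ʳ j) ≈ M₂ i j) →
      w₁ zero * (d₁ * d₂ * det M) ≈ w₁ zero * ((d₁ * d₂ - sum w₁ * sum w₂) * (det M₁ * det M₂))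
    det-join-nonempty {m} M₁ w₁ d₁ M₁w₁ M A B C D = begin
      w₁ zero * (d₁ * d₂ * det M)
        ≈⟨ solve 4 (λ w a b x → w :* (a :* b :* x) := a :* (b :* w :* x)) refl (w₁ zero) d₁ d₂ (det M) ⟩
      d₁ * (d₂ * w₁ zero * det M)
        ≈⟨ *-congˡ cramer ⟩
      d₁ * (f * (det E * det M₂))
        ≈⟨ solve 4 (λ d f e p → d :* (f :* (e :* p)) := f :* ((d :* e) :* p)) refl d₁ f (det E) (det M₂) ⟩
      f * ((d₁ * det E) * det M₂)
        ≈⟨ *-congˡ (*-congʳ cramer₁) ⟨
      f * ((w₁ zero * det M₁) * det M₂)
        ≈⟨ solve 4 (λ f w p q → f :* ((w :* p) :* q) := w :* (f :* (p :* q))) refl f (w₁ zero) (det M₁) (det M₂) ⟩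
      w₁ zero * (f * (det M₁ * det M₂)) ∎
      where
      f s₁ s₂ : Carrier
      s₁ = sum w₁
      s₂ = sum w₂
      f = d₁ * d₂ - s₁ * s₂

      W : Vector Carrier (suc m ℕ.+ n)
      W = (λ i → d₂ * w₁ i) ++ᵛ (λ j → s₁ * w₂ j)

      e : Column (suc m ℕ.+ n)
      e = replicateᵛ (suc m) 1# ++ᵛ replicateᵛ n 0#

      -- `det E` is an auxiliary unknown: Cramer's rule for `M` and for `M₁` both produce it, and
      -- multiplying the former by `d₁` allows it to be eliminated.
      E : Matrix Carrier (suc m)
      E = M₁ [ zero ]≔ const 1#

      N : Matrix Carrier (suc m ℕ.+ n)
      N = M [ zero ]≔ e

      eˡ : ∀ i → e (i ↑ˡ n) ≈ 1#
      eˡ i = reflexive (lookup-++ˡ (replicateᵛ (suc m) 1#) (replicateᵛ n 0#) i)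

      eʳ : ∀ j → e (suc m ↑ʳ j) ≈ 0#
      eʳ j = reflexive (lookup-++ʳ (replicateᵛ (suc m) 1#) (replicateᵛ n 0#) j)

      W-sum : ∀ k → sum (λ l → W l * M k l) ≈
                    d₂ * sum (λ i → w₁ i * M k (i ↑ˡ n)) + s₁ * sum (λ j → w₂ j * M k (suc m ↑ʳ j))
      W-sum k = begin
        sum (λ l → W l * M k l)
          ≈⟨ sum-↑ (suc m) (λ l → W l * M k l) ⟩
        sum (λ i → W (i ↑ˡ n) * M k (i ↑ˡ n)) + sum (λ j → W (suc m ↑ʳ j) * M k (suc m ↑ʳ j))
          ≈⟨ +-cong (sum-cong-≋ {suc m} λ i → *-congʳ {M k (i ↑ˡ n)} (reflexive (lookup-++ˡ (λ i → d₂ * w₁ i) (λ j → s₁ * w₂ j) i)))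
                    (sum-cong-≋ {n} λ j → *-congʳ {M k (suc m ↑ʳ j)} (reflexive (lookup-++ʳ (λ i → d₂ * w₁ i) (λ j → s₁ * w₂ j) j))) ⟩
        sum (λ i → d₂ * w₁ i * M k (i ↑ˡ n)) + sum (λ j → s₁ * w₂ j * M k (suc m ↑ʳ j))
          ≈⟨ +-cong (sum-*ˡ d₂ w₁ (λ i → M k (i ↑ˡ n))) (sum-*ˡ s₁ w₂ (λ j → M k (suc m ↑ʳ j))) ⟩
        d₂ * sum (λ i → w₁ i * M k (i ↑ˡ n)) + s₁ * sum (λ j → w₂ j * M k (suc m ↑ʳ j)) ∎

      sum-*-1 : ∀ {k} (w t : Vector Carrier k) → (∀ i → t i ≈ - 1#) → sum (λ i → w i * t i) ≈ sum w * - 1#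
      sum-*-1 w t t≈-1 = trans (sum-cong-≋ λ i → *-congˡ (t≈-1 i)) (sym (*-distribʳ-sum (- 1#) w))

      MW : ∀ k → sum (λ l → W l * M k l) ≈ f * e k
      MW = ↑-elim (suc m) _
        (λ i → begin
          sum (λ l → W l * M (i ↑ˡ n) l)
            ≈⟨ W-sum (i ↑ˡ n) ⟩
          d₂ * sum (λ j → w₁ j * M (i ↑ˡ n) (j ↑ˡ n)) + s₁ * sum (λ j → w₂ j * M (i ↑ˡ n) (suc m ↑ʳ j))
            ≈⟨ +-cong (*-congˡ (trans (sum-cong-≋ λ j → *-congˡ {w₁ j} (A i j)) (M₁w₁ i))) (*-congˡ (sum-*-1 w₂ _ (B i))) ⟩
          d₂ * d₁ + s₁ * (s₂ * - 1#)
            ≈⟨ +-cong (*-comm d₂ d₁) (trans (sym (*-assoc s₁ s₂ (- 1#))) (trans (*-comm _ _) (-1*x≈-x _))) ⟩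
          f
            ≈⟨ trans (*-congˡ (eˡ i)) (*-identityʳ f) ⟨
          f * e (i ↑ˡ n) ∎)
        (λ i → begin
          sum (λ l → W l * M (suc m ↑ʳ i) l)
            ≈⟨ W-sum (suc m ↑ʳ i) ⟩
          d₂ * sum (λ j → w₁ j * M (suc m ↑ʳ i) (j ↑ˡ n)) + s₁ * sum (λ j → w₂ j * M (suc m ↑ʳ i) (suc m ↑ʳ j))
            ≈⟨ +-cong (*-congˡ (sum-*-1 w₁ _ (C i))) (*-congˡ (trans (sum-cong-≋ λ j → *-congˡ {w₂ j} (D i j)) (M₂w₂ i))) ⟩
          d₂ * (s₁ * - 1#) + s₁ * d₂
            ≈⟨ +-cong (trans (sym (*-assoc d₂ s₁ (- 1#))) (trans (*-comm _ _) (-1*x≈-x _))) (*-comm s₁ d₂) ⟩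
          - (d₂ * s₁) + d₂ * s₁
            ≈⟨ -‿inverseˡ _ ⟩
          0#
            ≈⟨ trans (*-congˡ (eʳ i)) (zeroʳ f) ⟨
          f * e (suc m ↑ʳ i) ∎)

      scale-first-column : ∀ {k} (L : Matrix Carrier (suc k)) a (u v : Column (suc k)) → (∀ i → u i ≈ a * v i) →
                           det (L [ zero ]≔ u) ≈ a * det (L [ zero ]≔ v)
      scale-first-column L a u v u≈av = begin
        det (L [ zero ]≔ u)
          ≈⟨ det-linear zero a 0# _ (L [ zero ]≔ v) (L [ zero ]≔ v) agree agree
               (λ i → trans (u≈av i) (sym (vanish (v i)))) ⟩
        a * det (L [ zero ]≔ v) + 0# * det (L [ zero ]≔ v)
          ≈⟨ vanish _ ⟩
        a * det (L [ zero ]≔ v) ∎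
        where
        vanish : ∀ x → a * x + 0# * x ≈ a * x
        vanish x = trans (+-congˡ (zeroˡ x)) (+-identityʳ _)
        agree : ∀ i k → k ≢ zero → (L [ zero ]≔ u) i k ≈ (L [ zero ]≔ v) i k
        agree i zero    k≢0 = contradiction ≡.refl k≢0
        agree i (suc k) _   = refl

      cramer₁ : w₁ zero * det M₁ ≈ d₁ * det E
      cramer₁ = trans (sym (det-cramer M₁ w₁))
        (scale-first-column M₁ d₁ _ (const 1#) λ i → trans (M₁w₁ i) (sym (*-identityʳ d₁)))

      -- The new first column `e` is 1 on the first block and 0 on the second. Adding it to every
      -- column of the second block cancels the entries -1 in the upper right corner and leaves `M₂`
      -- untouched.
      shift : Vector Carrier (m ℕ.+ n)
      shift = replicateᵛ m 0# ++ᵛ replicateᵛ n 1#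

      shiftˡ : ∀ j → shift (j ↑ˡ n) ≈ 0#
      shiftˡ j = reflexive (lookup-++ˡ (replicateᵛ m 0#) (replicateᵛ n 1#) j)

      shiftʳ : ∀ j → shift (m ↑ʳ j) ≈ 1#
      shiftʳ j = reflexive (lookup-++ʳ (replicateᵛ m 0#) (replicateᵛ n 1#) j)

      corner : ∀ i j → shear N shift (i ↑ˡ n) (suc m ↑ʳ j) ≈ 0#
      corner i j = begin
        M (i ↑ˡ n) (suc m ↑ʳ j) + shift (m ↑ʳ j) * e (i ↑ˡ n)
          ≈⟨ +-cong (B i j) (trans (*-cong (shiftʳ j) (eˡ i)) (*-identityˡ 1#)) ⟩
        - 1# + 1#    ≈⟨ -‿inverseˡ 1# ⟩
        0#           ∎

      diagonalˡ : ∀ i j → shear N shift (i ↑ˡ n) (j ↑ˡ n) ≈ E i j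
      diagonalˡ i zero    = eˡ i
      diagonalˡ i (suc j) = trans (+-cong (A i (suc j)) (trans (*-congʳ (shiftˡ j)) (zeroˡ _))) (+-identityʳ _)

      diagonalʳ : ∀ i j → shear N shift (suc m ↑ʳ i) (suc m ↑ʳ j) ≈ M₂ i j
      diagonalʳ i j = trans (+-cong (D i j) (trans (*-congˡ (eʳ i)) (zeroʳ _))) (+-identityʳ _)

      cramer : d₂ * w₁ zero * det M ≈ f * (det E * det M₂)
      cramer = begin
        d₂ * w₁ zero * det M
          ≈⟨ det-cramer M W ⟨
        det (M [ zero ]≔ (λ k → sum (λ l → W l * M k l)))
          ≈⟨ scale-first-column M f _ e MW ⟩
        f * det N
          ≈⟨ *-congˡ (det-shear N shift) ⟨
        f * det (shear N shift)
          ≈⟨ *-congˡ (det-block-triangular (suc m) (shear N shift) corner) ⟩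
        f * (det (λ i j → shear N shift (i ↑ˡ n) (j ↑ˡ n)) * det (λ i j → shear N shift (suc m ↑ʳ i) (suc m ↑ʳ j)))
          ≈⟨ *-congˡ (*-cong (det-cong diagonalˡ) (det-cong diagonalʳ)) ⟩
        f * (det E * det M₂) ∎

    -- Cramer's rule is read in the first column of the first block, which leaves the factor
    -- `w₁ zero` to cancel. An empty first block has no such column, but then `sum w₁` is zero and
    -- `det M₁` is one, so both sides are d₁ d₂ det M₂.
    det-join : ∀ {m} (M₁ : Matrix Carrier m) (w₁ : Vector Carrier m) (d₁ : Carrier) →
      (∀ i → sum (λ j → w₁ j * M₁ i j) ≈ d₁) → (∀ i → Cancellative (w₁ i)) →
      (M : Matrix Carrier (m ℕ.+ n)) →
      (∀ i j → M (i ↑ˡ n) (j ↑ˡ n) ≈ M₁ i j) → (∀ i j → M (i ↑ˡ n) (m ↑ʳ j) ≈ - 1#) →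
      (∀ i j → M (m ↑ʳ i) (j ↑ˡ n) ≈ - 1#) → (∀ i j → M (m ↑ʳ i) (m ↑ʳ j) ≈ M₂ i j) →
      d₁ * d₂ * det M ≈ (d₁ * d₂ - sum w₁ * sum w₂) * (det M₁ * det M₂)
    det-join {suc m} M₁ w₁ d₁ M₁w₁ cancel M A B C D =
      cancel zero (det-join-nonempty M₁ w₁ d₁ M₁w₁ M A B C D)
    det-join {zero} M₁ w₁ d₁ _ _ M _ _ _ D = *-cong
      (sym (trans (+-congˡ (trans (-‿cong (zeroˡ _)) -0#≈0#)) (+-identityʳ _)))
      (trans (det-cong D) (sym (*-identityˡ _)))

  -- Row sums and total weight for a semi-regular bipartite graph

  infixl 8 ι_
  ι_ : ℕ → Carrier
  ι_ = fromℕ rawRing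

  ·≈ι* : ∀ n x → n · x ≈ (ι n) * x
  ·≈ι* n x = sym (trans (×-assoc-* n 1# x) (×-congʳ n (*-identityˡ x)))

  sum-if : ∀ {n} (f : Fin n → Bool) a → sum (λ i → if f i then a else 0#) ≈ ∣ tabulate f ∣ · a
  sum-if {zero}  f a = refl
  sum-if {suc n} f a with f zero
  ... | true  = +-congˡ (sum-if (f ∘ suc) a)
  ... | false = trans (+-identityˡ _) (sum-if (f ∘ suc) a)

  sum-if-lookup : ∀ {n} (V : Subset n) a → sum (λ i → if lookup V i then a else 0#) ≈ ∣ V ∣ · a
  sum-if-lookup V a = trans (sum-if (lookup V) a) (reflexive (≡.cong (λ W → ∣ W ∣ · a) (Vecₚ.tabulate∘lookup V)))

  sum-δ : ∀ {n} (w : Vector Carrier n) i x → sum (λ j → w j * (if does (i Finₚ.≟ j) then x else 0#)) ≈ w i * x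
  sum-δ w zero    x = trans (+-congˡ (sum-zero _ λ j → zeroʳ (w (suc j)))) (+-identityʳ _)
  sum-δ w (suc i) x = trans (+-cong (zeroʳ _) (sum-δ (w ∘ suc) i x)) (+-identityˡ _)

  indicator : Bool → Carrier
  indicator b = if b then 1# else 0#

  -- The element `x` is arbitrary here; it becomes the variable once `R` is a polynomial ring, and
  -- `charPoly≋det` makes the link with the characteristic polynomial.
  charMatrix : Carrier → ∀ {n} → Graph n → Matrix Carrier n
  charMatrix x G i j = (if does (i Finₚ.≟ j) then x else 0#) - adjacencyMatrix rawRing G i j

  module SemiRegular {n} {G : Graph n} {V₁ V₂ : Subset n} {q₁ q₂ : ℕ}
                     (semiRegular : IsSemiRegularBipartite G V₁ V₂ q₁ q₂) (x : Carrier) where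
    open IsSemiRegularBipartite semiRegular
    open IsBipartition bipartition

    -- This is the degree of `v`, since a vertex outside `V₁` lies in `V₂`. The Boolean test lets
    -- sums over the vertices be split by side.
    side : Fin n → ℕ
    side v = if lookup V₁ v then q₁ else q₂

    weight : Vector Carrier n
    weight v = x + ι side v

    ∈V₁⇒side : ∀ {v} → v ∈ V₁ → side v ≡ q₁
    ∈V₁⇒side v∈V₁ rewrite Vecₚ.[]=⇒lookup v∈V₁ = ≡.refl

    ∈V₂⇒∉V₁ : ∀ {v} → v ∈ V₂ → lookup V₁ v ≡ false
    ∈V₂⇒∉V₁ {v} v∈V₂ with lookup V₁ v in eq
    ... | true  = contradiction (Vecₚ.lookup⇒[]= v V₁ eq , v∈V₂) (disjoint v)
    ... | false = ≡.refl

    ∈V₁⇒∉V₂ : ∀ {v} → v ∈ V₁ → lookup V₂ v ≡ false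
    ∈V₁⇒∉V₂ {v} v∈V₁ with lookup V₂ v in eq
    ... | true  = contradiction (v∈V₁ , Vecₚ.lookup⇒[]= v V₂ eq) (disjoint v)
    ... | false = ≡.refl

    ∈V₂⇒side : ∀ {v} → v ∈ V₂ → side v ≡ q₂
    ∈V₂⇒side v∈V₂ rewrite ∈V₂⇒∉V₁ v∈V₂ = ≡.refl

    sum-degree : ∀ i a → sum (λ j → if adj G i j then a else 0#) ≈ (ι degree G i) * a
    sum-degree i a = trans (sum-if (adj G i) a) (·≈ι* (degree G i) a)

    -- The diagonal contributes (x + p) x, and the p neighbours, all of weight x + p′, contribute -p
    -- (x + p′). The terms p x cancel, and the remainder is symmetric in p and p′, hence the same on
    -- both sides of the graph.
    row : ∀ i {p p′} → side i ≡ p → degree G i ≡ p → (∀ j → adj G i j ≡ true → side j ≡ p′) →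
          sum (λ j → weight j * charMatrix x G i j) ≈ x * x - ι p * ι p′
    row i {p} {p′} ≡.refl deg nbrs = begin
      sum (λ j → weight j * charMatrix x G i j)
        ≈⟨ sum-cong-≋ {n} split ⟩
      sum (λ j → 1# * (weight j * (if does (i Finₚ.≟ j) then x else 0#)) + - 1# * (if adj G i j then x + ι p′ else 0#))
        ≈⟨ sum-linear 1# (- 1#) (λ j → weight j * (if does (i Finₚ.≟ j) then x else 0#)) (λ j → if adj G i j then x + ι p′ else 0#) ⟩
      1# * sum (λ j → weight j * (if does (i Finₚ.≟ j) then x else 0#)) + - 1# * sum (λ j → if adj G i j then x + ι p′ else 0#)
        ≈⟨ +-cong (trans (*-identityˡ _) (sum-δ weight i x)) (trans (-1*x≈-x _) (-‿cong (trans (sum-degree i _) (*-congʳ (reflexive (≡.cong ι_ deg)))))) ⟩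
      (x + ι p) * x - ι p * (x + ι p′)
        ≈⟨ solve 3 (λ x p q → (x :+ p) :* x :+ :- (p :* (x :+ q)) := x :* x :+ :- (p :* q)) refl x (ι p) (ι p′) ⟩
      x * x - ι p * ι p′ ∎
      where
      neighbour : ∀ j → weight j * (if adj G i j then 1# else 0#) ≈ (if adj G i j then x + ι p′ else 0#)
      neighbour j with adj G i j in eq
      ... | true  = trans (*-identityʳ _) (+-congˡ (reflexive (≡.cong ι_ (nbrs j eq))))
      ... | false = zeroʳ _

      split : ∀ j → weight j * charMatrix x G i j ≈
              1# * (weight j * (if does (i Finₚ.≟ j) then x else 0#)) + - 1# * (if adj G i j then x + ι p′ else 0#)
      split j = begin
        weight j * charMatrix x G i j
          ≈⟨ distribˡ _ _ _ ⟩
        weight j * (if does (i Finₚ.≟ j) then x else 0#) + weight j * - (if adj G i j then 1# else 0#)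
          ≈⟨ +-cong (sym (*-identityˡ _)) (trans (sym (-‿distribʳ-* _ _)) (trans (-‿cong (neighbour j)) (sym (-1*x≈-x _)))) ⟩
        1# * (weight j * (if does (i Finₚ.≟ j) then x else 0#)) + - 1# * (if adj G i j then x + ι p′ else 0#) ∎

    charMatrix-weight : ∀ i → sum (λ j → weight j * charMatrix x G i j) ≈ x * x - ι (q₁ ℕ.* q₂)
    charMatrix-weight i with cover i
    ... | inj₁ i∈V₁ = trans (row i (∈V₁⇒side i∈V₁) (degree₁ i i∈V₁) nbrs) (+-congˡ (-‿cong (sym (×1-homo-* q₁ q₂))))
      where
      nbrs : ∀ j → adj G i j ≡ true → side j ≡ q₂
      nbrs j eq with edges i j eq
      ... | inj₁ (_ , j∈V₂)    = ∈V₂⇒side j∈V₂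
      ... | inj₂ (i∈V₂ , _)    = contradiction (i∈V₁ , i∈V₂) (disjoint i)
    ... | inj₂ i∈V₂ = trans (row i (∈V₂⇒side i∈V₂) (degree₂ i i∈V₂) nbrs)
                        (+-congˡ (-‿cong (trans (*-comm _ _) (sym (×1-homo-* q₁ q₂)))))
      where
      nbrs : ∀ j → adj G i j ≡ true → side j ≡ q₁
      nbrs j eq with edges i j eq
      ... | inj₁ (i∈V₁ , _)    = contradiction (i∈V₁ , i∈V₂) (disjoint i)
      ... | inj₂ (_ , j∈V₁)    = ∈V₁⇒side j∈V₁

    edge-count : ∀ (V : Subset n) q → (∀ v → v ∈ V → degree G v ≡ q) →
      sum (λ i → sum (λ j → if lookup V i then indicator (adj G i j) else 0#)) ≈ ∣ V ∣ · (ι q)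
    edge-count V q deg = trans (sum-cong-≋ {n} inner) (sum-if-lookup V (ι q))
      where
      inner : ∀ i → sum (λ j → if lookup V i then indicator (adj G i j) else 0#) ≈ (if lookup V i then ι q else 0#)
      inner i with lookup V i in eq
      ... | true  = trans (sum-degree i 1#) (trans (*-identityʳ _) (reflexive (≡.cong ι_ (deg i (Vecₚ.lookup⇒[]= i V eq)))))
      ... | false = sum-replicate-zero n

    -- Every edge crosses, so an ordered pair of adjacent vertices starts in `V₁` exactly when it
    -- ends in `V₂`; exchanging the two summations counts the edges from the other side. With this
    -- the constant part of `sum weight` becomes twice the number of edges.
    double-count : ∣ V₁ ∣ · (ι q₁) ≈ ∣ V₂ ∣ · (ι q₂)
    double-count = begin
      ∣ V₁ ∣ · (ι q₁)
        ≈⟨ edge-count V₁ q₁ degree₁ ⟨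
      sum (λ i → sum (λ j → if lookup V₁ i then indicator (adj G i j) else 0#))
        ≈⟨ ∑-comm (λ i j → if lookup V₁ i then indicator (adj G i j) else 0#) ⟩
      sum (λ j → sum (λ i → if lookup V₁ i then indicator (adj G i j) else 0#))
        ≈⟨ sum-cong-≋ {n} (λ j → sum-cong-≋ {n} (flip j)) ⟩
      sum (λ j → sum (λ i → if lookup V₂ j then indicator (adj G j i) else 0#))
        ≈⟨ edge-count V₂ q₂ degree₂ ⟩
      ∣ V₂ ∣ · (ι q₂) ∎
      where
      if-0 : ∀ b → 0# ≈ (if b then 0# else 0#)
      if-0 true  = refl
      if-0 false = refl

      flip : ∀ j i → (if lookup V₁ i then indicator (adj G i j) else 0#) ≈ (if lookup V₂ j then indicator (adj G j i) else 0#)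
      flip j i rewrite adj-sym G j i with adj G i j in eq
      ... | false = trans (sym (if-0 (lookup V₁ i))) (if-0 (lookup V₂ j))
      ... | true with edges i j eq
      ...   | inj₁ (i∈V₁ , j∈V₂) rewrite Vecₚ.[]=⇒lookup i∈V₁ | Vecₚ.[]=⇒lookup j∈V₂ = refl
      ...   | inj₂ (i∈V₂ , j∈V₁) rewrite ∈V₂⇒∉V₁ i∈V₂ | ∈V₁⇒∉V₂ j∈V₁ = refl

    sum-weight : sum weight ≈ (ι n) * x + (ι (∣ V₁ ∣ ℕ.* q₁) + ι (∣ V₁ ∣ ℕ.* q₁))
    sum-weight = begin
      sum weight
        ≈⟨ ∑-distrib-+ (const x) (λ v → ι side v) ⟩
      sum {n} (const x) + sum (λ v → ι side v)
        ≈⟨ +-cong (trans (sum-replicate n) (·≈ι* n x)) (sum-cong-≋ {n} split) ⟩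
      (ι n) * x + sum (λ v → (if lookup V₁ v then ι q₁ else 0#) + (if lookup V₂ v then ι q₂ else 0#))
        ≈⟨ +-congˡ (∑-distrib-+ (λ v → if lookup V₁ v then ι q₁ else 0#) (λ v → if lookup V₂ v then ι q₂ else 0#)) ⟩
      (ι n) * x + (sum (λ v → if lookup V₁ v then ι q₁ else 0#) + sum (λ v → if lookup V₂ v then ι q₂ else 0#))
        ≈⟨ +-congˡ (+-cong (sum-if-lookup V₁ _) (trans (sum-if-lookup V₂ _) (sym double-count))) ⟩
      (ι n) * x + (∣ V₁ ∣ · (ι q₁) + ∣ V₁ ∣ · (ι q₁))
        ≈⟨ +-congˡ (+-cong edges≈ edges≈) ⟩
      (ι n) * x + (ι (∣ V₁ ∣ ℕ.* q₁) + ι (∣ V₁ ∣ ℕ.* q₁)) ∎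
      where
      edges≈ : ∣ V₁ ∣ · (ι q₁) ≈ ι (∣ V₁ ∣ ℕ.* q₁)
      edges≈ = trans (·≈ι* ∣ V₁ ∣ (ι q₁)) (sym (×1-homo-* ∣ V₁ ∣ q₁))

      split : ∀ v → ι side v ≈ (if lookup V₁ v then ι q₁ else 0#) + (if lookup V₂ v then ι q₂ else 0#)
      split v with cover v
      ... | inj₁ v∈V₁ rewrite Vecₚ.[]=⇒lookup v∈V₁ | ∈V₁⇒∉V₂ v∈V₁ = sym (+-identityʳ _)
      ... | inj₂ v∈V₂ rewrite ∈V₂⇒∉V₁ v∈V₂ | Vecₚ.[]=⇒lookup v∈V₂ = sym (+-identityˡ _)

  charMatrix-entry : ∀ x {b b′ a a′} → b ≡ b′ → a ≡ a′ →
    (if b then x else 0#) - (if a then 1# else 0#) ≈ (if b′ then x else 0#) - (if a′ then 1# else 0#)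
  charMatrix-entry x ≡.refl ≡.refl = refl

  det-charMatrix-∨ : ∀ x → (∀ q → Cancellative (x + ι q)) →
    ∀ {m n} {G : Graph m} {H : Graph n} {V₁ V₂ : Subset m} {V₃ V₄ : Subset n} {q₁ q₂ q₃ q₄} →
    IsSemiRegularBipartite G V₁ V₂ q₁ q₂ → IsSemiRegularBipartite H V₃ V₄ q₃ q₄ →
    let d₁ = x * x - ι (q₁ ℕ.* q₂)
        d₂ = x * x - ι (q₃ ℕ.* q₄)
        s₁ = (ι m) * x + (ι (∣ V₁ ∣ ℕ.* q₁) + ι (∣ V₁ ∣ ℕ.* q₁))
        s₂ = (ι n) * x + (ι (∣ V₃ ∣ ℕ.* q₃) + ι (∣ V₃ ∣ ℕ.* q₃))
    in d₁ * d₂ * det (charMatrix x (G ∨ H)) ≈ (d₁ * d₂ - s₁ * s₂) * (det (charMatrix x G) * det (charMatrix x H))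
  det-charMatrix-∨ x cancel {m} {n} {G} {H} semiRegular₁ semiRegular₂ = trans
    (det-join (charMatrix x H) S₂.weight _ S₂.charMatrix-weight
              (charMatrix x G) S₁.weight _ S₁.charMatrix-weight (λ i → cancel (S₁.side i))
              (charMatrix x (G ∨ H))
              (λ i j → charMatrix-entry x (does-≟-↑ˡ-↑ˡ n i j) (adj-∨-ˡˡ G H i j))
              (λ i j → trans (charMatrix-entry x (does-≟-↑ˡ-↑ʳ m n i j) (adj-∨-ˡʳ G H i j)) (+-identityˡ _))
              (λ i j → trans (charMatrix-entry x (does-≟-↑ʳ-↑ˡ m n i j) (adj-∨-ʳˡ G H i j)) (+-identityˡ _))
              (λ i j → charMatrix-entry x (does-≟-↑ʳ-↑ʳ m i j) (adj-∨-ʳʳ G H i j)))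
    (*-congʳ (+-congˡ (-‿cong (*-cong S₁.sum-weight S₂.sum-weight))))
    where
    module S₁ = SemiRegular semiRegular₁ x
    module S₂ = SemiRegular semiRegular₂ x

-- The commutative ring of polynomials as coefficient lists

module PolynomialRing {c ℓ} (R : CommutativeRing c ℓ) where
  open CommutativeRing R hiding (zero)
  open Polynomial rawRing renaming (rawRing to polynomialRawRing)
  open RingProperties ring using (-0#≈0#; +-cancelˡ)
  open CommutativeSemigroupProperties +-commutativeSemigroup using (interchange)

  -- Unlike _≈ᴾ_, the record type determines the two polynomials being compared.
  infix 4 _≋_
  record _≋_ (p q : Poly) : Set ℓ where
    constructor coefficientwise
    field at : p ≈ᴾ q
  open _≋_

  ≋-setoid : Setoid c ℓ
  ≋-setoid = record
    { _≈_           = _≋_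
    ; isEquivalence = record
      { refl  = coefficientwise λ _ → refl
      ; sym   = λ e → coefficientwise λ n → sym (at e n)
      ; trans = λ e f → coefficientwise λ n → trans (at e n) (at f n)
      }
    }

  open Setoid ≋-setoid public using () renaming (refl to ≋-refl; sym to ≋-sym; trans to ≋-trans)

  scale : Carrier → Poly → Poly
  scale a = map (a *_)

  -ᴾ_ : Poly → Poly
  -ᴾ_ = map (-_)

  coeff-+ : ∀ p q n → coeff (p +ᴾ q) n ≈ coeff p n + coeff q n
  coeff-+ []      q       n       = sym (+-identityˡ _)
  coeff-+ (a ∷ p) []      n       = sym (+-identityʳ _)
  coeff-+ (a ∷ p) (b ∷ q) zero    = refl
  coeff-+ (a ∷ p) (b ∷ q) (suc n) = coeff-+ p q n

  coeff-scale : ∀ a p n → coeff (scale a p) n ≈ a * coeff p n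
  coeff-scale a []      n       = sym (zeroʳ a)
  coeff-scale a (b ∷ p) zero    = refl
  coeff-scale a (b ∷ p) (suc n) = coeff-scale a p n

  coeff-neg : ∀ p n → coeff (-ᴾ p) n ≈ - coeff p n
  coeff-neg []      n       = sym -0#≈0#
  coeff-neg (b ∷ p) zero    = refl
  coeff-neg (b ∷ p) (suc n) = coeff-neg p n

  coeff-beyond : ∀ p n → length p ℕ.≤ n → coeff p n ≈ 0#
  coeff-beyond []      n       _           = refl
  coeff-beyond (a ∷ p) (suc n) (ℕ.s≤s p≤n) = coeff-beyond p n p≤n

  ∷-cong : ∀ {a b p q} → a ≈ b → p ≋ q → a ∷ p ≋ b ∷ q
  ∷-cong a≈b p≋q = coefficientwise λ { zero → a≈b ; (suc n) → at p≋q n }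

  ∷-zero : ∀ {a p} → a ≈ 0# → p ≋ [] → a ∷ p ≋ []
  ∷-zero a≈0 p≋[] = coefficientwise λ { zero → a≈0 ; (suc n) → at p≋[] n }

  +ᴾ-cong : ∀ {p p′ q q′} → p ≋ p′ → q ≋ q′ → p +ᴾ q ≋ p′ +ᴾ q′
  +ᴾ-cong {p} {p′} {q} {q′} e f = coefficientwise λ n →
    trans (coeff-+ p q n) (trans (+-cong (at e n) (at f n)) (sym (coeff-+ p′ q′ n)))

  +ᴾ-assoc : ∀ p q r → (p +ᴾ q) +ᴾ r ≋ p +ᴾ (q +ᴾ r)
  +ᴾ-assoc p q r = coefficientwise λ n → begin
    coeff ((p +ᴾ q) +ᴾ r) n                ≈⟨ coeff-+ (p +ᴾ q) r n ⟩
    coeff (p +ᴾ q) n + coeff r n           ≈⟨ +-congʳ (coeff-+ p q n) ⟩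
    coeff p n + coeff q n + coeff r n      ≈⟨ +-assoc _ _ _ ⟩
    coeff p n + (coeff q n + coeff r n)    ≈⟨ +-congˡ (coeff-+ q r n) ⟨
    coeff p n + coeff (q +ᴾ r) n           ≈⟨ coeff-+ p (q +ᴾ r) n ⟨
    coeff (p +ᴾ (q +ᴾ r)) n                ∎
    where open SetoidReasoning setoid

  +ᴾ-comm : ∀ p q → p +ᴾ q ≋ q +ᴾ p
  +ᴾ-comm p q = coefficientwise λ n → trans (coeff-+ p q n) (trans (+-comm _ _) (sym (coeff-+ q p n)))

  +ᴾ-identityʳ : ∀ p → p +ᴾ [] ≋ p
  +ᴾ-identityʳ p = +ᴾ-comm p []

  +ᴾ-interchange : ∀ p q r s → (p +ᴾ q) +ᴾ (r +ᴾ s) ≋ (p +ᴾ r) +ᴾ (q +ᴾ s)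
  +ᴾ-interchange p q r s = coefficientwise λ n → begin
    coeff ((p +ᴾ q) +ᴾ (r +ᴾ s)) n                      ≈⟨ expand p q r s n ⟩
    coeff p n + coeff q n + (coeff r n + coeff s n)     ≈⟨ interchange _ _ _ _ ⟩
    coeff p n + coeff r n + (coeff q n + coeff s n)     ≈⟨ expand p r q s n ⟨
    coeff ((p +ᴾ r) +ᴾ (q +ᴾ s)) n                      ∎
    where
    open SetoidReasoning setoid
    expand : ∀ p q r s n → coeff ((p +ᴾ q) +ᴾ (r +ᴾ s)) n ≈ coeff p n + coeff q n + (coeff r n + coeff s n)
    expand p q r s n = trans (coeff-+ (p +ᴾ q) (r +ᴾ s) n) (+-cong (coeff-+ p q n) (coeff-+ r s n))

  -ᴾ-cong : ∀ {p q} → p ≋ q → -ᴾ p ≋ -ᴾ q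
  -ᴾ-cong {p} {q} e = coefficientwise λ n →
    trans (coeff-neg p n) (trans (-‿cong (at e n)) (sym (coeff-neg q n)))

  -ᴾ-inverseˡ : ∀ p → -ᴾ p +ᴾ p ≋ []
  -ᴾ-inverseˡ p = coefficientwise λ n →
    trans (coeff-+ (-ᴾ p) p n) (trans (+-congʳ (coeff-neg p n)) (-‿inverseˡ _))

  scale-cong : ∀ {a b p q} → a ≈ b → p ≋ q → scale a p ≋ scale b q
  scale-cong {a} {b} {p} {q} a≈b p≋q = coefficientwise λ n →
    trans (coeff-scale a p n) (trans (*-cong a≈b (at p≋q n)) (sym (coeff-scale b q n)))

  scale-0 : ∀ {a} p → a ≈ 0# → scale a p ≋ []
  scale-0 {a} p a≈0 = coefficientwise λ n → trans (coeff-scale a p n) (trans (*-congʳ a≈0) (zeroˡ _))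

  scale-1 : ∀ p → scale 1# p ≋ p
  scale-1 p = coefficientwise λ n → trans (coeff-scale 1# p n) (*-identityˡ _)

  scale-+ : ∀ a b p → scale (a + b) p ≋ scale a p +ᴾ scale b p
  scale-+ a b p = coefficientwise λ n → trans (coeff-scale (a + b) p n) (trans (distribʳ _ a b)
    (sym (trans (coeff-+ (scale a p) (scale b p) n) (+-cong (coeff-scale a p n) (coeff-scale b p n)))))

  scale-+ᴾ : ∀ a p q → scale a (p +ᴾ q) ≋ scale a p +ᴾ scale a q
  scale-+ᴾ a p q = coefficientwise λ n → trans (coeff-scale a (p +ᴾ q) n)
    (trans (*-congˡ (coeff-+ p q n)) (trans (distribˡ a _ _)
    (sym (trans (coeff-+ (scale a p) (scale a q) n) (+-cong (coeff-scale a p n) (coeff-scale a q n))))))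

  scale-* : ∀ a b p → scale (a * b) p ≋ scale a (scale b p)
  scale-* a b p = coefficientwise λ n → trans (coeff-scale (a * b) p n) (trans (*-assoc a b _)
    (sym (trans (coeff-scale a (scale b p) n) (*-congˡ (coeff-scale b p n)))))

  *ᴾ-zeroʳ : ∀ p → p *ᴾ [] ≋ []
  *ᴾ-zeroʳ []      = ≋-refl
  *ᴾ-zeroʳ (a ∷ p) = ∷-zero refl (*ᴾ-zeroʳ p)

  *ᴾ-congˡ : ∀ p {q r} → q ≋ r → p *ᴾ q ≋ p *ᴾ r
  *ᴾ-congˡ []      e = ≋-refl
  *ᴾ-congˡ (a ∷ p) e = +ᴾ-cong (scale-cong refl e) (∷-cong refl (*ᴾ-congˡ p e))

  -- The product recurses on its left factor; this is the mirror image of that recursion, and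
  -- commutativity follows from the two by induction.
  *ᴾ-∷ʳ : ∀ p b q → p *ᴾ (b ∷ q) ≋ scale b p +ᴾ (0# ∷ p *ᴾ q)
  *ᴾ-∷ʳ []      b q = ≋-sym (∷-zero refl ≋-refl)
  *ᴾ-∷ʳ (a ∷ p) b q = ∷-cong (+-congʳ (*-comm a b)) (begin
    scale a q +ᴾ p *ᴾ (b ∷ q)                       ≈⟨ +ᴾ-cong ≋-refl (*ᴾ-∷ʳ p b q) ⟩
    scale a q +ᴾ (scale b p +ᴾ (0# ∷ p *ᴾ q))       ≈⟨ +ᴾ-assoc (scale a q) (scale b p) _ ⟨
    (scale a q +ᴾ scale b p) +ᴾ (0# ∷ p *ᴾ q)       ≈⟨ +ᴾ-cong (+ᴾ-comm (scale a q) (scale b p)) ≋-refl ⟩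
    (scale b p +ᴾ scale a q) +ᴾ (0# ∷ p *ᴾ q)       ≈⟨ +ᴾ-assoc (scale b p) (scale a q) _ ⟩
    scale b p +ᴾ (scale a q +ᴾ (0# ∷ p *ᴾ q))       ∎)
    where open SetoidReasoning ≋-setoid

  *ᴾ-comm : ∀ p q → p *ᴾ q ≋ q *ᴾ p
  *ᴾ-comm []      q = ≋-sym (*ᴾ-zeroʳ q)
  *ᴾ-comm (a ∷ p) q = ≋-trans (+ᴾ-cong ≋-refl (∷-cong refl (*ᴾ-comm p q))) (≋-sym (*ᴾ-∷ʳ q a p))

  *ᴾ-cong : ∀ {p p′ q q′} → p ≋ p′ → q ≋ q′ → p *ᴾ q ≋ p′ *ᴾ q′
  *ᴾ-cong {p} {p′} {q} {q′} e f = begin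
    p *ᴾ q      ≈⟨ *ᴾ-congˡ p f ⟩
    p *ᴾ q′     ≈⟨ *ᴾ-comm p q′ ⟩
    q′ *ᴾ p     ≈⟨ *ᴾ-congˡ q′ e ⟩
    q′ *ᴾ p′    ≈⟨ *ᴾ-comm q′ p′ ⟩
    p′ *ᴾ q′    ∎
    where open SetoidReasoning ≋-setoid

  *ᴾ-distribʳ : ∀ r p q → (p +ᴾ q) *ᴾ r ≋ p *ᴾ r +ᴾ q *ᴾ r
  *ᴾ-distribʳ r []      q       = ≋-refl
  *ᴾ-distribʳ r (a ∷ p) []      = ≋-sym (+ᴾ-identityʳ _)
  *ᴾ-distribʳ r (a ∷ p) (b ∷ q) = begin
    scale (a + b) r +ᴾ (0# ∷ (p +ᴾ q) *ᴾ r)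
      ≈⟨ +ᴾ-cong (scale-+ a b r) (∷-cong (sym (+-identityˡ 0#)) (*ᴾ-distribʳ r p q)) ⟩
    (scale a r +ᴾ scale b r) +ᴾ ((0# ∷ p *ᴾ r) +ᴾ (0# ∷ q *ᴾ r))
      ≈⟨ +ᴾ-interchange (scale a r) (scale b r) (0# ∷ p *ᴾ r) (0# ∷ q *ᴾ r) ⟩
    (a ∷ p) *ᴾ r +ᴾ (b ∷ q) *ᴾ r ∎
    where open SetoidReasoning ≋-setoid

  *ᴾ-distribˡ : ∀ r p q → r *ᴾ (p +ᴾ q) ≋ r *ᴾ p +ᴾ r *ᴾ q
  *ᴾ-distribˡ r p q = ≋-trans (*ᴾ-comm r (p +ᴾ q))
    (≋-trans (*ᴾ-distribʳ r p q) (+ᴾ-cong (*ᴾ-comm p r) (*ᴾ-comm q r)))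

  scale-*ᴾ : ∀ a p q → scale a p *ᴾ q ≋ scale a (p *ᴾ q)
  scale-*ᴾ a []      q = ≋-refl
  scale-*ᴾ a (b ∷ p) q = begin
    scale (a * b) q +ᴾ (0# ∷ scale a p *ᴾ q)           ≈⟨ +ᴾ-cong (scale-* a b q) (∷-cong (sym (zeroʳ a)) (scale-*ᴾ a p q)) ⟩
    scale a (scale b q) +ᴾ scale a (0# ∷ p *ᴾ q)       ≈⟨ scale-+ᴾ a (scale b q) (0# ∷ p *ᴾ q) ⟨
    scale a ((b ∷ p) *ᴾ q)                             ∎
    where open SetoidReasoning ≋-setoid

  *ᴾ-assoc : ∀ p q r → (p *ᴾ q) *ᴾ r ≋ p *ᴾ (q *ᴾ r)
  *ᴾ-assoc []      q r = ≋-refl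
  *ᴾ-assoc (a ∷ p) q r = begin
    (scale a q +ᴾ (0# ∷ p *ᴾ q)) *ᴾ r                  ≈⟨ *ᴾ-distribʳ r (scale a q) (0# ∷ p *ᴾ q) ⟩
    scale a q *ᴾ r +ᴾ (0# ∷ p *ᴾ q) *ᴾ r               ≈⟨ +ᴾ-cong (scale-*ᴾ a q r) (+ᴾ-cong (scale-0 r refl) ≋-refl) ⟩
    scale a (q *ᴾ r) +ᴾ (0# ∷ (p *ᴾ q) *ᴾ r)           ≈⟨ +ᴾ-cong ≋-refl (∷-cong refl (*ᴾ-assoc p q r)) ⟩
    (a ∷ p) *ᴾ (q *ᴾ r)                                ∎
    where open SetoidReasoning ≋-setoid

  *ᴾ-identityˡ : ∀ p → (1# ∷ []) *ᴾ p ≋ p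
  *ᴾ-identityˡ p = ≋-trans (+ᴾ-cong (scale-1 p) (∷-zero refl ≋-refl)) (+ᴾ-identityʳ p)

  commutativeRing : CommutativeRing c ℓ
  commutativeRing = record
    { isCommutativeRing = isPolynomialRing }
    where
    isPolynomialRing : IsCommutativeRing _≈ᴾ_ _+ᴾ_ _*ᴾ_ -ᴾ_ [] (1# ∷ [])
    isPolynomialRing = record
      { isRing = record
        { +-isAbelianGroup = record
          { isGroup = record
            { isMonoid = record
              { isSemigroup = record
                { isMagma = record
                  { isEquivalence = record
                    { refl  = λ _ → refl
                    ; sym   = λ e n → sym (e n)
                    ; trans = λ e f n → trans (e n) (f n)
                    }
                  ; ∙-cong = λ {p} {q} {r} {s} e f → at (+ᴾ-cong {p} {q} {r} {s} (coefficientwise e) (coefficientwise f))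
                  }
                ; assoc = λ p q r → at (+ᴾ-assoc p q r)
                }
              ; identity = (λ _ _ → refl) , (λ p → at (+ᴾ-identityʳ p))
              }
            ; inverse = (λ p → at (-ᴾ-inverseˡ p)) , (λ p → at (≋-trans (+ᴾ-comm p (-ᴾ p)) (-ᴾ-inverseˡ p)))
            ; ⁻¹-cong = λ {p} {q} e → at (-ᴾ-cong {p} {q} (coefficientwise e))
            }
          ; comm = λ p q → at (+ᴾ-comm p q)
          }
        ; *-cong     = λ {p} {q} {r} {s} e f → at (*ᴾ-cong {p} {q} {r} {s} (coefficientwise e) (coefficientwise f))
        ; *-assoc    = λ p q r → at (*ᴾ-assoc p q r)
        ; *-identity = (λ p → at (*ᴾ-identityˡ p)) , (λ p → at (≋-trans (*ᴾ-comm p (1# ∷ [])) (*ᴾ-identityˡ p)))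
        ; distrib    = (λ r p q → at (*ᴾ-distribˡ r p q)) , (λ r p q → at (*ᴾ-distribʳ r p q))
        }
      ; *-comm = λ p q → at (*ᴾ-comm p q)
      }

  open JoinDeterminant commutativeRing using (Cancellative; charMatrix; ι_)

  -- The coefficients of u are recovered from those of (X + a)u downwards from the degree.
  linear-cancellative : ∀ a → Cancellative (X +ᴾ (a ∷ []))
  linear-cancellative a {u} {v} e n =
    equal (length u ℕ.⊔ length v) n
      (ℕₚ.≤-trans (ℕₚ.m≤m⊔n (length u) (length v)) (ℕₚ.m≤n+m _ n))
      (ℕₚ.≤-trans (ℕₚ.m≤n⊔m (length u) (length v)) (ℕₚ.m≤n+m _ n))
    where
    open SetoidReasoning setoid

    coeff-linear : ∀ p n → coeff ((X +ᴾ (a ∷ [])) *ᴾ p) (suc n) ≈ (0# + a) * coeff p (suc n) + coeff p n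
    coeff-linear p n = begin
      coeff (scale (0# + a) p +ᴾ (0# ∷ (1# ∷ []) *ᴾ p)) (suc n)
        ≈⟨ coeff-+ (scale (0# + a) p) (0# ∷ (1# ∷ []) *ᴾ p) (suc n) ⟩
      coeff (scale (0# + a) p) (suc n) + coeff ((1# ∷ []) *ᴾ p) n
        ≈⟨ +-cong (coeff-scale (0# + a) p (suc n)) (at (*ᴾ-identityˡ p) n) ⟩
      (0# + a) * coeff p (suc n) + coeff p n ∎

    -- List length stands in for the degree, since trailing coefficients cannot be tested for zero.
    -- The recursion is on `k`, a bound for the distance from `n` to the end of the longer list. At
    -- each step the leading coefficient 1 of the factor isolates `coeff u n`.
    equal : ∀ k n → length u ℕ.≤ n ℕ.+ k → length v ℕ.≤ n ℕ.+ k → coeff u n ≈ coeff v n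
    equal zero n u≤ v≤ = trans (coeff-beyond u n (≡.subst (length u ℕ.≤_) (ℕₚ.+-identityʳ n) u≤))
      (sym (coeff-beyond v n (≡.subst (length v ℕ.≤_) (ℕₚ.+-identityʳ n) v≤)))
    equal (suc k) n u≤ v≤ = +-cancelˡ ((0# + a) * coeff u (suc n)) _ _ (begin
      (0# + a) * coeff u (suc n) + coeff u n     ≈⟨ coeff-linear u n ⟨
      coeff ((X +ᴾ (a ∷ [])) *ᴾ u) (suc n)       ≈⟨ e (suc n) ⟩
      coeff ((X +ᴾ (a ∷ [])) *ᴾ v) (suc n)       ≈⟨ coeff-linear v n ⟩
      (0# + a) * coeff v (suc n) + coeff v n     ≈⟨ +-congʳ (*-congˡ (equal k (suc n)
                                                      (≡.subst (length u ℕ.≤_) (ℕₚ.+-suc n k) u≤)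
                                                      (≡.subst (length v ℕ.≤_) (ℕₚ.+-suc n k) v≤))) ⟨
      (0# + a) * coeff u (suc n) + coeff v n     ∎)

  -- The numerals of the polynomial ring and the constant numerals are different lists, already at
  -- zero: `[]` against `0# ∷ []`.
  constant-ι : ∀ n → fromℕ rawRing n ∷ [] ≋ ι n
  constant-ι zero    = ∷-zero refl ≋-refl
  constant-ι (suc n) = +ᴾ-cong {1# ∷ []} ≋-refl (constant-ι n)

  constant-* : ∀ a b → (a ∷ []) *ᴾ (b ∷ []) ≋ a * b ∷ []
  constant-* a b = ∷-cong (+-identityʳ _) ≋-refl

  -- Turns a coefficient list into an expression in the ring operations, where the solver applies.
  ∷-horner : ∀ a p → a ∷ p ≋ (a ∷ []) +ᴾ X *ᴾ p
  ∷-horner a p = ≋-sym (begin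
    (a ∷ []) +ᴾ X *ᴾ p                            ≈⟨ +ᴾ-cong {a ∷ []} ≋-refl (+ᴾ-cong (scale-0 p refl) (∷-cong refl (*ᴾ-identityˡ p))) ⟩
    (a ∷ []) +ᴾ (0# ∷ p)                          ≈⟨ ∷-cong (+-identityʳ a) ≋-refl ⟩
    a ∷ p                                         ∎)
    where open SetoidReasoning ≋-setoid

  X+ι-cancellative : ∀ q → Cancellative (X +ᴾ ι q)
  X+ι-cancellative q {u} {v} e = linear-cancellative (fromℕ rawRing q) {u} {v}
    (at (≋-trans (*ᴾ-cong linear≋ ≋-refl) (≋-trans (coefficientwise e) (*ᴾ-cong (≋-sym linear≋) ≋-refl))))
    where
    linear≋ : X +ᴾ (fromℕ rawRing q ∷ []) ≋ X +ᴾ ι q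
    linear≋ = +ᴾ-cong {X} ≋-refl (constant-ι q)

  -- One matrix negates an entry before making it a constant polynomial, the other subtracts
  -- polynomials; they differ as lists where vertices are not adjacent, `- 0# ∷ []` against `[]`.
  charPoly≋det : ∀ {n} (G : Graph n) →
    charPoly (adjacencyMatrix rawRing G) ≋ Determinant.det polynomialRawRing (charMatrix X G)
  charPoly≋det G = coefficientwise (DeterminantProperties.det-cong commutativeRing
    {M = λ i j → (if does (i Finₚ.≟ j) then X else []) +ᴾ (- adjacencyMatrix rawRing G i j ∷ [])}
    {N = charMatrix X G}
    (λ i j → at (+ᴾ-cong {if does (i Finₚ.≟ j) then X else []} ≋-refl (entry (adj G i j)))))
    where
    entry : ∀ b → - (if b then 1# else 0#) ∷ [] ≋ -ᴾ (if b then 1# ∷ [] else [])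
    entry true  = ≋-refl
    entry false = ∷-zero -0#≈0# ≋-refl

-- Products over lists of roots, the quartic, and cancellation of common factors

module Factorisation {c ℓ} (R : CommutativeRing c ℓ) where
  open CommutativeRing R hiding (zero)
  open IntegerCoefficients R
  open JoinDeterminant R
  open SemiringMult semiring using (×-homo-+; ×1-homo-*)
  open SetoidReasoning setoid

  -- In the polynomial ring, with `f` sending a root to its linear factor, this is the product that
  -- `IsMultisetOfZeros` compares with.
  product : ∀ {a} {A : Set a} → (A → Carrier) → List A → Carrier
  product f = foldr (λ a p → f a * p) 1#

  module _ {a} {A : Set a} (f : A → Carrier) where

    product-++ : ∀ as bs → product f (as ++ bs) ≈ product f as * product f bs
    product-++ []       bs = sym (*-identityˡ _)
    product-++ (a ∷ as) bs = trans (*-congˡ (product-++ as bs)) (sym (*-assoc _ _ _))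

    product-replicate-+ : ∀ k l z → product f (replicate (k ℕ.+ l) z) ≈ product f (replicate k z) * product f (replicate l z)
    product-replicate-+ zero    l z = sym (*-identityˡ _)
    product-replicate-+ (suc k) l z = trans (*-congˡ (product-replicate-+ k l z)) (sym (*-assoc _ _ _))

    -- The spectrum of the join lists the zero eigenvalues of both graphs together at the end,
    -- whereas each graph has its own after its nonzero ones.
    product-merge : ∀ as bs k l z →
      product f (as ++ bs ++ replicate (k ℕ.+ l) z) ≈ product f (as ++ replicate k z) * product f (bs ++ replicate l z)
    product-merge as bs k l z = begin
      product f (as ++ bs ++ replicate (k ℕ.+ l) z)
        ≈⟨ trans (product-++ as _) (*-congˡ (trans (product-++ bs _) (*-congˡ (product-replicate-+ k l z)))) ⟩
      product f as * (product f bs * (product f (replicate k z) * product f (replicate l z)))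
        ≈⟨ solve 4 (λ a b c d → a :* (b :* (c :* d)) := (a :* c) :* (b :* d)) refl
             (product f as) (product f bs) (product f (replicate k z)) (product f (replicate l z)) ⟩
      (product f as * product f (replicate k z)) * (product f bs * product f (replicate l z))
        ≈⟨ *-cong (product-++ as (replicate k z)) (product-++ bs (replicate l z)) ⟨
      product f (as ++ replicate k z) * product f (bs ++ replicate l z) ∎

  product-map : ∀ {a b} {A : Set a} {B : Set b} (f : B → Carrier) (g : A → B) as → product f (map g as) ≡ product (f ∘ g) as
  product-map f g []       = ≡.refl
  product-map f g (a ∷ as) = ≡.cong (f (g a) *_) (product-map f g as)

  -- Only the sum and the product of the roots enter, so `β` need not be literally `- α` and `γ` may
  -- be a numeral known merely to be a square up to `_≈_`.
  difference-of-squares : ∀ x α β γ → α + β ≈ 0# → α * β ≈ - γ → (x + α) * (x + β) ≈ x * x - γ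
  difference-of-squares x α β γ α+β≈0 αβ≈-γ = begin
    (x + α) * (x + β)                 ≈⟨ solve 3 (λ x a b → (x :+ a) :* (x :+ b) := x :* x :+ (x :* (a :+ b) :+ a :* b)) refl x α β ⟩
    x * x + (x * (α + β) + α * β)     ≈⟨ +-congˡ (+-cong (trans (*-congˡ α+β≈0) (zeroʳ x)) αβ≈-γ) ⟩
    x * x + (0# - γ)                  ≈⟨ +-congˡ (+-identityˡ _) ⟩
    x * x - γ                         ∎

  -- The left side is the Horner form of the coefficient list of f. Once `ι` is distributed over
  -- sums and products this is a plain expansion, in which q₁q₂ and q₃q₄ remain atoms because f
  -- involves the degrees only through them.
  quartic-factorisation : ∀ x q₁ q₂ q₃ q₄ ν₁ ν₂ ε₁ ε₂ →
    (ι (q₁ ℕ.* q₂ ℕ.* q₃ ℕ.* q₄) - ι (4 ℕ.* ε₁ ℕ.* ε₂)) + x * (- ι (2 ℕ.* (ν₁ ℕ.* ε₂ ℕ.+ ν₂ ℕ.* ε₁))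
      + x * (- ι (q₁ ℕ.* q₂ ℕ.+ q₃ ℕ.* q₄ ℕ.+ ν₁ ℕ.* ν₂) + x * (0# + x * 1#)))
    ≈ (x * x - ι (q₁ ℕ.* q₂)) * (x * x - ι (q₃ ℕ.* q₄)) - (ι ν₁ * x + (ι ε₁ + ι ε₁)) * (ι ν₂ * x + (ι ε₂ + ι ε₂))
  quartic-factorisation x q₁ q₂ q₃ q₄ ν₁ ν₂ ε₁ ε₂ = begin
    (ι (q₁ ℕ.* q₂ ℕ.* q₃ ℕ.* q₄) - ι (4 ℕ.* ε₁ ℕ.* ε₂)) + x * (- ι (2 ℕ.* (ν₁ ℕ.* ε₂ ℕ.+ ν₂ ℕ.* ε₁))
      + x * (- ι (q₁ ℕ.* q₂ ℕ.+ q₃ ℕ.* q₄ ℕ.+ ν₁ ℕ.* ν₂) + x * (0# + x * 1#)))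
      ≈⟨ +-cong (+-cong constant (-‿cong (trans (*-homo (4 ℕ.* ε₁) ε₂) (*-congʳ (*-homo 4 ε₁)))))
           (*-congˡ (+-cong (-‿cong linear) (*-congˡ (+-cong (-‿cong quadratic) (*-congˡ (trans (+-identityˡ _) (*-identityʳ x))))))) ⟩
    (ι (q₁ ℕ.* q₂) * ι (q₃ ℕ.* q₄) - ι 4 * ι ε₁ * ι ε₂) + x * (- (ι 2 * (ι ν₁ * ι ε₂ + ι ν₂ * ι ε₁))
      + x * (- (ι (q₁ ℕ.* q₂) + ι (q₃ ℕ.* q₄) + ι ν₁ * ι ν₂) + x * x))
      ≈⟨ solve 7 (λ x a b m n e g →
           (a :* b :+ :- (con (+ 4) :* e :* g)) :+ x :* (:- (con (+ 2) :* (m :* g :+ n :* e)) :+ x :* (:- (a :+ b :+ m :* n) :+ x :* x))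
             := (x :* x :+ :- a) :* (x :* x :+ :- b) :+ :- ((m :* x :+ (e :+ e)) :* (n :* x :+ (g :+ g)))) refl
           x (ι (q₁ ℕ.* q₂)) (ι (q₃ ℕ.* q₄)) (ι ν₁) (ι ν₂) (ι ε₁) (ι ε₂) ⟩
    (x * x - ι (q₁ ℕ.* q₂)) * (x * x - ι (q₃ ℕ.* q₄)) - (ι ν₁ * x + (ι ε₁ + ι ε₁)) * (ι ν₂ * x + (ι ε₂ + ι ε₂)) ∎
    where
    *-homo : ∀ m n → ι (m ℕ.* n) ≈ ι m * ι n
    *-homo = ×1-homo-*
    +-homo : ∀ m n → ι (m ℕ.+ n) ≈ ι m + ι n
    +-homo = ×-homo-+ 1#
    constant : ι (q₁ ℕ.* q₂ ℕ.* q₃ ℕ.* q₄) ≈ ι (q₁ ℕ.* q₂) * ι (q₃ ℕ.* q₄)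
    constant = trans (*-homo (q₁ ℕ.* q₂ ℕ.* q₃) q₄) (trans (*-congʳ (*-homo (q₁ ℕ.* q₂) q₃))
      (trans (*-assoc _ _ _) (*-congˡ (sym (*-homo q₃ q₄)))))
    linear : ι (2 ℕ.* (ν₁ ℕ.* ε₂ ℕ.+ ν₂ ℕ.* ε₁)) ≈ ι 2 * (ι ν₁ * ι ε₂ + ι ν₂ * ι ε₁)
    linear = trans (*-homo 2 (ν₁ ℕ.* ε₂ ℕ.+ ν₂ ℕ.* ε₁)) (*-congˡ (trans (+-homo (ν₁ ℕ.* ε₂) (ν₂ ℕ.* ε₁)) (+-cong (*-homo ν₁ ε₂) (*-homo ν₂ ε₁))))
    quadratic : ι (q₁ ℕ.* q₂ ℕ.+ q₃ ℕ.* q₄ ℕ.+ ν₁ ℕ.* ν₂) ≈ ι (q₁ ℕ.* q₂) + ι (q₃ ℕ.* q₄) + ι ν₁ * ι ν₂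
    quadratic = trans (+-homo (q₁ ℕ.* q₂ ℕ.+ q₃ ℕ.* q₄) (ν₁ ℕ.* ν₂)) (+-cong (+-homo (q₁ ℕ.* q₂) (q₃ ℕ.* q₄)) (*-homo ν₁ ν₂))

  -- Regularity is available for linear polynomials, so d₁d₂ is split into its four linear factors,
  -- which are removed one after the other.
  cancel-common-factors : ∀ {a₁ b₁ a₂ b₂ d₁ d₂ r₁ r₂ p₁ p₂ f D} →
    Cancellative a₁ → Cancellative b₁ → Cancellative a₂ → Cancellative b₂ →
    a₁ * b₁ ≈ d₁ → a₂ * b₂ ≈ d₂ → p₁ ≈ a₁ * (b₁ * r₁) → p₂ ≈ a₂ * (b₂ * r₂) →
    d₁ * d₂ * D ≈ f * (p₁ * p₂) → D ≈ f * (r₁ * r₂)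
  cancel-common-factors {a₁} {b₁} {a₂} {b₂} {d₁} {d₂} {r₁} {r₂} {p₁} {p₂} {f} {D}
                        cancel-a₁ cancel-b₁ cancel-a₂ cancel-b₂ ab₁ ab₂ p₁≈ p₂≈ eq =
    cancel-b₂ (cancel-a₂ (cancel-b₁ (cancel-a₁ (begin
      a₁ * (b₁ * (a₂ * (b₂ * D)))
        ≈⟨ solve 5 (λ a b c d x → a :* (b :* (c :* (d :* x))) := (a :* b) :* (c :* d) :* x) refl a₁ b₁ a₂ b₂ D ⟩
      a₁ * b₁ * (a₂ * b₂) * D
        ≈⟨ *-congʳ (*-cong ab₁ ab₂) ⟩
      d₁ * d₂ * D
        ≈⟨ eq ⟩
      f * (p₁ * p₂)
        ≈⟨ *-congˡ (*-cong p₁≈ p₂≈) ⟩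
      f * (a₁ * (b₁ * r₁) * (a₂ * (b₂ * r₂)))
        ≈⟨ solve 7 (λ f a b c d r s → f :* (a :* (b :* r) :* (c :* (d :* s))) := a :* (b :* (c :* (d :* (f :* (r :* s)))))) refl
             f a₁ b₁ a₂ b₂ r₁ r₂ ⟩
      a₁ * (b₁ * (a₂ * (b₂ * (f * (r₁ * r₂))))) ∎))))

-- The spectrum of a join over an arbitrary commutative ring

-- Stated over a raw ring so that its instance at ℂ-rawRing is syntactically close to IsSpectrum;
-- otherwise conversion unfolds the arithmetic of ℂ.
module JoinSpectrum {c ℓ} (S : RawRing c ℓ)
  (isCommutativeRing : IsCommutativeRing (RawRing._≈_ S) (RawRing._+_ S) (RawRing._*_ S) (RawRing.-_ S) (RawRing.0# S) (RawRing.1# S))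
  where

  R : CommutativeRing c ℓ
  R = record { isCommutativeRing = isCommutativeRing }

  open CommutativeRing R hiding (zero; rawRing; isCommutativeRing)
  open Polynomial S renaming (rawRing to polynomialRawRing; IsMultisetOfZeros to IsMultisetOfZerosˢ)
  open PolynomialRing R
  open RingProperties ring using (-0#≈0#; -‿distribˡ-*; -‿distribʳ-*; -‿+-comm; -‿involutive)
  module P = CommutativeRing commutativeRing
  module PF = Factorisation commutativeRing
  module PJ = JoinDeterminant commutativeRing

  ιˢ : ℕ → Carrier
  ιˢ = fromℕ S

  -- The polynomial `quartic` over any raw ring. At `ℂ-rawRing` the two agree by definition, so
  -- `quartic-zeros` is an identity function.
  quarticPoly : (q₁ q₂ q₃ q₄ ν₁ ν₂ ε₁ ε₂ : ℕ) → Poly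
  quarticPoly q₁ q₂ q₃ q₄ ν₁ ν₂ ε₁ ε₂ =
      (ιˢ (q₁ ℕ.* q₂ ℕ.* q₃ ℕ.* q₄) + - ιˢ (4 ℕ.* ε₁ ℕ.* ε₂))
    ∷ (- ιˢ (2 ℕ.* (ν₁ ℕ.* ε₂ ℕ.+ ν₂ ℕ.* ε₁)))
    ∷ (- ιˢ (q₁ ℕ.* q₂ ℕ.+ q₃ ℕ.* q₄ ℕ.+ ν₁ ℕ.* ν₂))
    ∷ 0#
    ∷ 1#
    ∷ []

  linear : Carrier → Poly
  linear a = X +ᴾ (- a ∷ [])

  open _≋_

  quarticPoly-factorisation : ∀ q₁ q₂ q₃ q₄ ν₁ ν₂ ε₁ ε₂ →
    quarticPoly q₁ q₂ q₃ q₄ ν₁ ν₂ ε₁ ε₂ ≋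
      (X P.* X P.- PJ.ι (q₁ ℕ.* q₂)) P.* (X P.* X P.- PJ.ι (q₃ ℕ.* q₄)) P.-
      (PJ.ι ν₁ P.* X P.+ (PJ.ι ε₁ P.+ PJ.ι ε₁)) P.* (PJ.ι ν₂ P.* X P.+ (PJ.ι ε₂ P.+ PJ.ι ε₂))
  quarticPoly-factorisation q₁ q₂ q₃ q₄ ν₁ ν₂ ε₁ ε₂ =
    ≋-trans horner (coefficientwise (PF.quartic-factorisation X q₁ q₂ q₃ q₄ ν₁ ν₂ ε₁ ε₂))
    where
    A B C D : ℕ
    A = q₁ ℕ.* q₂ ℕ.* q₃ ℕ.* q₄
    B = 4 ℕ.* ε₁ ℕ.* ε₂
    C = 2 ℕ.* (ν₁ ℕ.* ε₂ ℕ.+ ν₂ ℕ.* ε₁)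
    D = q₁ ℕ.* q₂ ℕ.+ q₃ ℕ.* q₄ ℕ.+ ν₁ ℕ.* ν₂

    step : ∀ {a p q r} → a ∷ [] ≋ q → p ≋ r → a ∷ p ≋ q +ᴾ X *ᴾ r
    step {a} {p} a≋q p≋r = ≋-trans (∷-horner a p) (+ᴾ-cong a≋q (*ᴾ-congˡ X p≋r))

    horner : quarticPoly q₁ q₂ q₃ q₄ ν₁ ν₂ ε₁ ε₂ ≋
      (PJ.ι A P.- PJ.ι B) P.+ X P.* (P.- PJ.ι C P.+ X P.* (P.- PJ.ι D P.+ X P.* (P.0# P.+ X P.* P.1#)))
    horner = step (+ᴾ-cong {ιˢ A ∷ []} (constant-ι A) (-ᴾ-cong (constant-ι B)))
      (step (-ᴾ-cong (constant-ι C)) (step (-ᴾ-cong (constant-ι D)) (step (∷-zero refl ≋-refl) ≋-refl)))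

  linear-pair : ∀ a b n → a + b ≈ 0# → a * b ≈ - ιˢ n → linear a *ᴾ linear b ≈ᴾ X P.* X P.- PJ.ι n
  linear-pair a b n a+b≈0 ab≈-n = PF.difference-of-squares X (- a ∷ []) (- b ∷ []) (PJ.ι n)
    (at (∷-zero (trans (-‿+-comm a b) (trans (-‿cong a+b≈0) -0#≈0#)) ≋-refl))
    (at (≋-trans (constant-* (- a) (- b)) (≋-trans (∷-cong double-neg ≋-refl) (-ᴾ-cong (constant-ι n)))))
    where
    double-neg : - a * - b ≈ - ιˢ n
    double-neg = trans (sym (-‿distribˡ-* a (- b))) (trans (-‿cong (sym (-‿distribʳ-* a b)))
      (trans (-‿involutive _) ab≈-n))

  -- The pairs `l`, `l′` and `μ`, `μ′` are ±λ₁ and ±μ₁, known through their sums and products alone.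
  -- The roots are images under `g` because the eigenvalues are listed as reals and embedded by
  -- `ofℝ`; the θ are complex from the start.
  join-spectrum : ∀ {m n} {G : Graph m} {H : Graph n} {V₁ V₂ : Subset m} {V₃ V₄ : Subset n} {q₁ q₂ q₃ q₄} →
    IsSemiRegularBipartite G V₁ V₂ q₁ q₂ → IsSemiRegularBipartite H V₃ V₄ q₃ q₄ →
    ∀ {a} {A : Set a} (g : A → Carrier) {l l′ μ μ′ z : A} →
    g l + g l′ ≈ 0# → g l * g l′ ≈ - ιˢ (q₁ ℕ.* q₂) → g μ + g μ′ ≈ 0# → g μ * g μ′ ≈ - ιˢ (q₃ ℕ.* q₄) →
    ∀ as bs h k θs →
    IsMultisetOfZerosˢ (charPoly (adjacencyMatrix S G)) (map g (l ∷ l′ ∷ as ++ replicate h z)) →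
    IsMultisetOfZerosˢ (charPoly (adjacencyMatrix S H)) (map g (μ ∷ μ′ ∷ bs ++ replicate k z)) →
    IsMultisetOfZerosˢ (quarticPoly q₁ q₂ q₃ q₄ m n (∣ V₁ ∣ ℕ.* q₁) (∣ V₃ ∣ ℕ.* q₃)) θs →
    IsMultisetOfZerosˢ (charPoly (adjacencyMatrix S (G ∨ H))) (θs ++ map g (as ++ bs ++ replicate (h ℕ.+ k) z))
  join-spectrum {m} {n} {G} {H} {V₁} {V₃ = V₃} {q₁ = q₁} {q₂} {q₃} {q₄} sr₁ sr₂ g {l} {l′} {μ} {μ′} {z}
                l+l′ ll′ μ+μ′ μμ′ as bs h k θs spec₁ spec₂ specθ =
    at (begin
      charPoly (adjacencyMatrix S (G ∨ H))
        ≈⟨ charPoly≋det (G ∨ H) ⟩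
      det (PJ.charMatrix X (G ∨ H))
        ≈⟨ coefficientwise (PF.cancel-common-factors
             {linear (g l)} {linear (g l′)} {linear (g μ)} {linear (g μ′)} {d₁} {d₂} {r₁} {r₂}
             {det (PJ.charMatrix X G)} {det (PJ.charMatrix X H)} {f} {det (PJ.charMatrix X (G ∨ H))}
             (λ {u} {v} → linear-cancellative (- g l) {u} {v}) (λ {u} {v} → linear-cancellative (- g l′) {u} {v})
             (λ {u} {v} → linear-cancellative (- g μ) {u} {v}) (λ {u} {v} → linear-cancellative (- g μ′) {u} {v})
             (linear-pair (g l) (g l′) (q₁ ℕ.* q₂) l+l′ ll′) (linear-pair (g μ) (g μ′) (q₃ ℕ.* q₄) μ+μ′ μμ′)
             (at p₁≋)
             (at p₂≋)
             (PJ.det-charMatrix-∨ X (λ q {u} {v} → X+ι-cancellative q {u} {v}) sr₁ sr₂)) ⟩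
      f *ᴾ (r₁ *ᴾ r₂)
        ≈⟨ *ᴾ-cong f≋ rs≋ ⟩
      PF.product linear θs *ᴾ PF.product linear (map g (as ++ bs ++ replicate (h ℕ.+ k) z))
        ≈⟨ coefficientwise (PF.product-++ linear θs (map g (as ++ bs ++ replicate (h ℕ.+ k) z))) ⟨
      PF.product linear (θs ++ map g (as ++ bs ++ replicate (h ℕ.+ k) z)) ∎)
    where
    open SetoidReasoning ≋-setoid
    open Determinant polynomialRawRing using (det)
    ε₁ ε₂ : ℕ
    ε₁ = ∣ V₁ ∣ ℕ.* q₁
    ε₂ = ∣ V₃ ∣ ℕ.* q₃
    d₁ d₂ f r₁ r₂ : Poly
    d₁ = X P.* X P.- PJ.ι (q₁ ℕ.* q₂)
    d₂ = X P.* X P.- PJ.ι (q₃ ℕ.* q₄)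
    f = d₁ P.* d₂ P.- (PJ.ι m P.* X P.+ (PJ.ι ε₁ P.+ PJ.ι ε₁)) P.* (PJ.ι n P.* X P.+ (PJ.ι ε₂ P.+ PJ.ι ε₂))
    r₁ = PF.product linear (map g (as ++ replicate h z))
    r₂ = PF.product linear (map g (bs ++ replicate k z))

    p₁≋ : det (PJ.charMatrix X G) ≋ linear (g l) *ᴾ (linear (g l′) *ᴾ r₁)
    p₁≋ = ≋-trans (≋-sym (charPoly≋det G)) (coefficientwise spec₁)

    p₂≋ : det (PJ.charMatrix X H) ≋ linear (g μ) *ᴾ (linear (g μ′) *ᴾ r₂)
    p₂≋ = ≋-trans (≋-sym (charPoly≋det H)) (coefficientwise spec₂)

    f≋ : f ≋ PF.product linear θs
    f≋ = ≋-trans (≋-sym (quarticPoly-factorisation q₁ q₂ q₃ q₄ m n ε₁ ε₂)) (coefficientwise specθ)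

    ≡⇒≋ : ∀ {p q} → p ≡ q → p ≋ q
    ≡⇒≋ ≡.refl = ≋-refl

    rs≋ : r₁ *ᴾ r₂ ≋ PF.product linear (map g (as ++ bs ++ replicate (h ℕ.+ k) z))
    rs≋ = begin
      r₁ *ᴾ r₂
        ≈⟨ ≡⇒≋ (≡.cong₂ _*ᴾ_ (PF.product-map linear g (as ++ replicate h z)) (PF.product-map linear g (bs ++ replicate k z))) ⟩
      PF.product (linear ∘ g) (as ++ replicate h z) *ᴾ PF.product (linear ∘ g) (bs ++ replicate k z)
        ≈⟨ coefficientwise (PF.product-merge (linear ∘ g) as bs h k z) ⟨
      PF.product (linear ∘ g) (as ++ bs ++ replicate (h ℕ.+ k) z)
        ≈⟨ ≡⇒≋ (PF.product-map linear g (as ++ bs ++ replicate (h ℕ.+ k) z)) ⟨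
      PF.product linear (map g (as ++ bs ++ replicate (h ℕ.+ k) z)) ∎

-- Null sequences

open _≈ℝ_

IsNull : (ℕ → ℚ) → Set
IsNull s = ∀ ε → 0ℚ ℚ.< ε → Eventually (λ n → ℚ.∣ s n ∣ ℚ.< ε)

null-resp : ∀ {s t} → (∀ n → s n ≡ t n) → IsNull s → IsNull t
null-resp s≡t null ε 0<ε with null ε 0<ε
... | N , h = N , λ n N≤n → ≡.subst (λ x → ℚ.∣ x ∣ ℚ.< ε) (s≡t n) (h n N≤n)

null-zero : ∀ {s} → (∀ n → s n ≡ 0ℚ) → IsNull s
null-zero s≡0 ε 0<ε = 0 , λ n _ → ≡.subst (λ x → ℚ.∣ x ∣ ℚ.< ε) (≡.sym (s≡0 n)) 0<ε

null-neg : ∀ {s} → IsNull s → IsNull (λ n → ℚ.- s n)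
null-neg {s} null ε 0<ε with null ε 0<ε
... | N , h = N , λ n N≤n → ≡.subst (ℚ._< ε) (≡.sym (ℚₚ.∣-p∣≡∣p∣ (s n))) (h n N≤n)

null-+ : ∀ {s t} → IsNull s → IsNull t → IsNull (λ n → s n ℚ.+ t n)
null-+ {s} {t} null-s null-t ε 0<ε with null-s (½ ℚ.* ε) 0<δ | null-t (½ ℚ.* ε) 0<δ
  where
  0<δ : 0ℚ ℚ.< ½ ℚ.* ε
  0<δ = ≡.subst (ℚ._< ½ ℚ.* ε) (ℚₚ.*-zeroʳ ½) (ℚₚ.*-monoʳ-<-pos ½ 0<ε)
... | N₁ , h₁ | N₂ , h₂ = N₁ ℕ.⊔ N₂ , λ n N≤n → begin-strict
  ℚ.∣ s n ℚ.+ t n ∣             ≤⟨ ℚₚ.∣p+q∣≤∣p∣+∣q∣ (s n) (t n) ⟩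
  ℚ.∣ s n ∣ ℚ.+ ℚ.∣ t n ∣       <⟨ ℚₚ.+-mono-< (h₁ n (ℕₚ.m⊔n≤o⇒m≤o N₁ N₂ N≤n)) (h₂ n (ℕₚ.m⊔n≤o⇒n≤o N₁ N₂ N≤n)) ⟩
  ½ ℚ.* ε ℚ.+ ½ ℚ.* ε           ≡⟨ ℚₚ.*-distribʳ-+ ε ½ ½ ⟨
  1ℚ ℚ.* ε                      ≡⟨ ℚₚ.*-identityˡ ε ⟩
  ε                             ∎
  where open ℚₚ.≤-Reasoning

-- A Cauchy sequence is eventually bounded by some B > 0, so it suffices to bring `s` below ε / B.
null-* : ∀ {s t} → IsNull s → IsCauchy t → IsNull (λ n → s n ℚ.* t n)
null-* {s} {t} null-s cauchy-t ε 0<ε with cauchy⇒bounded t cauchy-t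
... | B , B-pos , N₁ , t≤B = N₁ ℕ.⊔ N₂ , bound
  where
  instance
    _ = B-pos
    B≢0 = ℚₚ.pos⇒nonZero B
    B⁻¹-pos = ℚₚ.1/pos⇒pos B

  δ : ℚ
  δ = ℚ.1/ B ℚ.* ε

  0<δ : 0ℚ ℚ.< δ
  0<δ = ≡.subst (ℚ._< δ) (ℚₚ.*-zeroʳ (ℚ.1/ B)) (ℚₚ.*-monoʳ-<-pos (ℚ.1/ B) 0<ε)

  N₂ = proj₁ (null-s δ 0<δ)

  bound : ∀ n → N₁ ℕ.⊔ N₂ ℕ.≤ n → ℚ.∣ s n ℚ.* t n ∣ ℚ.< ε
  bound n N≤n = begin-strict
    ℚ.∣ s n ℚ.* t n ∣           ≡⟨ ℚₚ.∣p*q∣≡∣p∣*∣q∣ (s n) (t n) ⟩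
    ℚ.∣ s n ∣ ℚ.* ℚ.∣ t n ∣     ≤⟨ ℚₚ.*-monoˡ-≤-nonNeg ℚ.∣ s n ∣ {{ℚₚ.∣-∣-nonNeg (s n)}} (t≤B n (ℕₚ.m⊔n≤o⇒m≤o N₁ N₂ N≤n)) ⟩
    ℚ.∣ s n ∣ ℚ.* B             <⟨ ℚₚ.*-monoˡ-<-pos B (proj₂ (null-s δ 0<δ) n (ℕₚ.m⊔n≤o⇒n≤o N₁ N₂ N≤n)) ⟩
    ℚ.1/ B ℚ.* ε ℚ.* B          ≡⟨ ≡.cong (ℚ._* B) (ℚₚ.*-comm (ℚ.1/ B) ε) ⟩
    ε ℚ.* ℚ.1/ B ℚ.* B          ≡⟨ ℚₚ.*-assoc ε (ℚ.1/ B) B ⟩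
    ε ℚ.* (ℚ.1/ B ℚ.* B)        ≡⟨ ≡.cong (ε ℚ.*_) (ℚₚ.*-inverseˡ B) ⟩
    ε ℚ.* 1ℚ                    ≡⟨ ℚₚ.*-identityʳ ε ⟩
    ε                           ∎
    where open ℚₚ.≤-Reasoning

-- Real and complex numbers as commutative rings

-- A multiplicative law of ℂ splits into a real and an imaginary identity, and each of them holds
-- exactly in ℚ at every index of the representing sequences.
module RingIdentities {c ℓ} (R : CommutativeRing c ℓ) where
  open CommutativeRing R
  open RingProperties ring using (-0#≈0#; -‿distribʳ-*)
  open IntegerCoefficients R using (solve; _:=_; _:+_; _:*_; :-_)

  *-assoc-re : ∀ a b c d e f → (a * c - b * d) * e - (a * d + b * c) * f ≈ a * (c * e - d * f) - b * (c * f + d * e)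
  *-assoc-re = solve 6 (λ a b c d e f →
    (a :* c :+ :- (b :* d)) :* e :+ :- ((a :* d :+ b :* c) :* f) := a :* (c :* e :+ :- (d :* f)) :+ :- (b :* (c :* f :+ d :* e))) refl

  *-assoc-im : ∀ a b c d e f → (a * c - b * d) * f + (a * d + b * c) * e ≈ a * (c * f + d * e) + b * (c * e - d * f)
  *-assoc-im = solve 6 (λ a b c d e f →
    (a :* c :+ :- (b :* d)) :* f :+ (a :* d :+ b :* c) :* e := a :* (c :* f :+ d :* e) :+ b :* (c :* e :+ :- (d :* f))) refl

  distribˡ-re : ∀ a b c d e f → a * (c + e) - b * (d + f) ≈ (a * c - b * d) + (a * e - b * f)
  distribˡ-re = solve 6 (λ a b c d e f →
    a :* (c :+ e) :+ :- (b :* (d :+ f)) := (a :* c :+ :- (b :* d)) :+ (a :* e :+ :- (b :* f))) refl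

  distribˡ-im : ∀ a b c d e f → a * (d + f) + b * (c + e) ≈ (a * d + b * c) + (a * f + b * e)
  distribˡ-im = solve 6 (λ a b c d e f →
    a :* (d :+ f) :+ b :* (c :+ e) := (a :* d :+ b :* c) :+ (a :* f :+ b :* e)) refl

  distribʳ-re : ∀ a b c d e f → (c + e) * a - (d + f) * b ≈ (c * a - d * b) + (e * a - f * b)
  distribʳ-re = solve 6 (λ a b c d e f →
    (c :+ e) :* a :+ :- ((d :+ f) :* b) := (c :* a :+ :- (d :* b)) :+ (e :* a :+ :- (f :* b))) refl

  distribʳ-im : ∀ a b c d e f → (c + e) * b + (d + f) * a ≈ (c * b + d * a) + (e * b + f * a)
  distribʳ-im = solve 6 (λ a b c d e f →
    (c :+ e) :* b :+ (d :+ f) :* a := (c :* b :+ d :* a) :+ (e :* b :+ f :* a)) refl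

  *-identityˡ-re : ∀ a b → 1# * a - 0# * b ≈ a
  *-identityˡ-re a b = trans (+-cong (*-identityˡ a) (trans (-‿cong (zeroˡ b)) -0#≈0#)) (+-identityʳ a)

  *-identityˡ-im : ∀ a b → 1# * b + 0# * a ≈ b
  *-identityˡ-im a b = trans (+-cong (*-identityˡ b) (zeroˡ a)) (+-identityʳ b)

  *-identityʳ-re : ∀ a b → a * 1# - b * 0# ≈ a
  *-identityʳ-re a b = trans (+-cong (*-identityʳ a) (trans (-‿cong (zeroʳ b)) -0#≈0#)) (+-identityʳ a)

  *-identityʳ-im : ∀ a b → a * 0# + b * 1# ≈ b
  *-identityʳ-im a b = trans (+-cong (zeroʳ a) (*-identityʳ b)) (+-identityˡ b)

  *-comm-re : ∀ a b c d → a * c - b * d ≈ c * a - d * b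
  *-comm-re a b c d = +-cong (*-comm a c) (-‿cong (*-comm b d))

  *-comm-im : ∀ a b c d → a * d + b * c ≈ c * b + d * a
  *-comm-im a b c d = trans (+-comm _ _) (+-cong (*-comm b c) (*-comm a d))

  -- Together with `x0+0y` this computes the product of the embedded reals x and -x; the value
  -- `- 0#` there is the imaginary part of a negated numeral.
  x[-x]-00 : ∀ x → x * - x - 0# * 0# ≈ - (x * x)
  x[-x]-00 x = trans (+-cong (sym (-‿distribʳ-* x x)) (trans (-‿cong (zeroˡ 0#)) -0#≈0#)) (+-identityʳ _)

  x0+0y : ∀ x y → x * 0# + 0# * y ≈ - 0#
  x0+0y x y = trans (+-cong (zeroʳ x) (zeroˡ y)) (trans (+-identityˡ 0#) (sym -0#≈0#))

  neg-difference : ∀ a b → - (a - b) ≈ b - a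
  neg-difference = solve 2 (λ a b → :- (a :+ :- b) := b :+ :- a) refl

  difference-trans : ∀ a b c → (a - b) + (b - c) ≈ a - c
  difference-trans = solve 3 (λ a b c → (a :+ :- b) :+ (b :+ :- c) := a :+ :- c) refl

  difference-+ : ∀ a b c d → (a - b) + (c - d) ≈ (a + c) - (b + d)
  difference-+ = solve 4 (λ a b c d → (a :+ :- b) :+ (c :+ :- d) := (a :+ c) :+ :- (b :+ d)) refl

  difference-* : ∀ a b c d → (a - b) * c + (c - d) * b ≈ a * c - b * d
  difference-* = solve 4 (λ a b c d → (a :+ :- b) :* c :+ (c :+ :- d) :* b := a :* c :+ :- (b :* d)) refl

module ℚ-Identities = RingIdentities ℚₚ.+-*-commutativeRing

≡⇒≈ℝ : ∀ {x y} → (∀ n → seq x n ≡ seq y n) → x ≈ℝ y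
≡⇒≈ℝ {x} {y} eq = mk≈ℝ (null-zero λ n →
  ≡.trans (≡.cong (ℚ._- seq y n) (eq n)) (ℚₚ.+-inverseʳ (seq y n)))

≈ℝ-isEquivalence : IsEquivalence _≈ℝ_
≈ℝ-isEquivalence = record
  { refl  = ≡⇒≈ℝ λ _ → ≡.refl
  ; sym   = λ {x} {y} e → mk≈ℝ (null-resp
      (λ n → ℚ-Identities.neg-difference (seq x n) (seq y n))
      (null-neg (difference-null e)))
  ; trans = λ {x} {y} {z} e f → mk≈ℝ (null-resp
      (λ n → ℚ-Identities.difference-trans (seq x n) (seq y n) (seq z n))
      (null-+ (difference-null e) (difference-null f)))
  }

+ℝ-cong : ∀ {x y u v} → x ≈ℝ y → u ≈ℝ v → (x +ℝ u) ≈ℝ (y +ℝ v)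
+ℝ-cong {x} {y} {u} {v} e f = mk≈ℝ (null-resp
  (λ n → ℚ-Identities.difference-+
           (seq x n) (seq y n) (seq u n) (seq v n))
  (null-+ (difference-null e) (difference-null f)))

-- From x u - y v = (x - y) u + (u - v) y, where each summand is a null sequence times a Cauchy
-- sequence.
*ℝ-cong : ∀ {x y u v} → x ≈ℝ y → u ≈ℝ v → (x *ℝ u) ≈ℝ (y *ℝ v)
*ℝ-cong {x} {y} {u} {v} e f = mk≈ℝ (null-resp
  (λ n → ℚ-Identities.difference-*
           (seq x n) (seq y n) (seq u n) (seq v n))
  (null-+ (null-* (difference-null e) (cauchy u)) (null-* (difference-null f) (cauchy y))))

-ℝ-cong : ∀ {x y} → x ≈ℝ y → (-ℝ x) ≈ℝ (-ℝ y)
-ℝ-cong {x} {y} e = mk≈ℝ (null-resp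
  (λ n → ℚₚ.neg-distrib-+ (seq x n) (ℚ.- seq y n))
  (null-neg (difference-null e)))

-- The laws of ℂ are reduced to ℚ coordinate by coordinate: comparing two real numbers
-- by conversion would unfold their Cauchy moduli.
≈ℝ-resp : ∀ {x y u v} → (∀ n → seq x n ≡ seq u n) → (∀ n → seq y n ≡ seq v n) → u ≈ℝ v → x ≈ℝ y
≈ℝ-resp x≡u y≡v (mk≈ℝ null) = mk≈ℝ (null-resp (λ n → ≡.sym (≡.cong₂ ℚ._-_ (x≡u n) (y≡v n))) null)

ℂ-commutativeRing : CommutativeRing 0ℓ 0ℓ
ℂ-commutativeRing = record { isCommutativeRing = isCommutativeRing }
  where
  open RawRing ℂ-rawRing
  open IsEquivalence ≈ℝ-isEquivalence using () renaming (refl to ≈ℝ-refl; sym to ≈ℝ-sym; trans to ≈ℝ-trans)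
  module I = ℚ-Identities

  *-comm : ∀ z w → z * w ≈ w * z
  *-comm (a +i b) (c +i d) =
    (≡⇒≈ℝ λ n → I.*-comm-re (seq a n) (seq b n) (seq c n) (seq d n)) ,
    (≡⇒≈ℝ λ n → I.*-comm-im (seq a n) (seq b n) (seq c n) (seq d n))

  *-assoc : ∀ z w v → (z * w) * v ≈ z * (w * v)
  *-assoc (a +i b) (c +i d) (e +i f) =
    (≡⇒≈ℝ λ n → I.*-assoc-re (seq a n) (seq b n) (seq c n) (seq d n) (seq e n) (seq f n)) ,
    (≡⇒≈ℝ λ n → I.*-assoc-im (seq a n) (seq b n) (seq c n) (seq d n) (seq e n) (seq f n))

  *-identityˡ : ∀ z → 1# * z ≈ z
  *-identityˡ (a +i b) =
    (≡⇒≈ℝ λ n → I.*-identityˡ-re (seq a n) (seq b n)) , (≡⇒≈ℝ λ n → I.*-identityˡ-im (seq a n) (seq b n))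

  distribˡ : ∀ x y z → x * (y + z) ≈ x * y + x * z
  distribˡ (a +i b) (c +i d) (e +i f) =
    (≡⇒≈ℝ λ n → I.distribˡ-re (seq a n) (seq b n) (seq c n) (seq d n) (seq e n) (seq f n)) ,
    (≡⇒≈ℝ λ n → I.distribˡ-im (seq a n) (seq b n) (seq c n) (seq d n) (seq e n) (seq f n))

  *-identityʳ : ∀ z → z * 1# ≈ z
  *-identityʳ (a +i b) =
    (≡⇒≈ℝ λ n → I.*-identityʳ-re (seq a n) (seq b n)) , (≡⇒≈ℝ λ n → I.*-identityʳ-im (seq a n) (seq b n))

  distribʳ : ∀ x y z → (y + z) * x ≈ y * x + z * x
  distribʳ (a +i b) (c +i d) (e +i f) =
    (≡⇒≈ℝ λ n → I.distribʳ-re (seq a n) (seq b n) (seq c n) (seq d n) (seq e n) (seq f n)) ,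
    (≡⇒≈ℝ λ n → I.distribʳ-im (seq a n) (seq b n) (seq c n) (seq d n) (seq e n) (seq f n))

  ≈-trans : ∀ {x y z} → x ≈ y → y ≈ z → x ≈ z
  ≈-trans (p , q) (r , s) = ≈ℝ-trans p r , ≈ℝ-trans q s

  +-cong : ∀ {x y u v} → x ≈ y → u ≈ v → x + u ≈ y + v
  +-cong {a +i b} {c +i d} {e +i f} {g +i h} (p , q) (r , s) =
    +ℝ-cong {a} {c} {e} {g} p r , +ℝ-cong {b} {d} {f} {h} q s

  *-cong : ∀ {x y u v} → x ≈ y → u ≈ v → x * u ≈ y * v
  *-cong {a +i b} {c +i d} {e +i f} {g +i h} (p , q) (r , s) =
    ≈ℝ-resp (λ _ → ≡.refl) (λ _ → ≡.refl)
      (+ℝ-cong {a *ℝ e} {c *ℝ g} { -ℝ (b *ℝ f)} { -ℝ (d *ℝ h)} (*ℝ-cong {a} {c} {e} {g} p r) (-ℝ-cong {b *ℝ f} {d *ℝ h} (*ℝ-cong {b} {d} {f} {h} q s))) ,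
    ≈ℝ-resp (λ _ → ≡.refl) (λ _ → ≡.refl)
      (+ℝ-cong {a *ℝ f} {c *ℝ h} {b *ℝ e} {d *ℝ g} (*ℝ-cong {a} {c} {f} {h} p s) (*ℝ-cong {b} {d} {e} {g} q r))

  isCommutativeRing : IsCommutativeRing _≈_ _+_ _*_ -_ 0# 1#
  isCommutativeRing = record
    { isRing = record
      { +-isAbelianGroup = record
        { isGroup = record
          { isMonoid = record
            { isSemigroup = record
              { isMagma = record
                { isEquivalence = record
                  { refl  = (≡⇒≈ℝ λ _ → ≡.refl) , (≡⇒≈ℝ λ _ → ≡.refl)
                  ; sym   = λ (p , q) → ≈ℝ-sym p , ≈ℝ-sym q
                  ; trans = ≈-trans
                  }
                ; ∙-cong = +-cong
                }
              ; assoc   = λ (a +i b) (c +i d) (e +i f) →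
                  (≡⇒≈ℝ λ n → ℚₚ.+-assoc (seq a n) (seq c n) (seq e n)) ,
                  (≡⇒≈ℝ λ n → ℚₚ.+-assoc (seq b n) (seq d n) (seq f n))
              }
            ; identity = (λ (a +i b) → (≡⇒≈ℝ λ n → ℚₚ.+-identityˡ (seq a n)) , (≡⇒≈ℝ λ n → ℚₚ.+-identityˡ (seq b n)))
                       , (λ (a +i b) → (≡⇒≈ℝ λ n → ℚₚ.+-identityʳ (seq a n)) , (≡⇒≈ℝ λ n → ℚₚ.+-identityʳ (seq b n)))
            }
          ; inverse = (λ (a +i b) → (≡⇒≈ℝ λ n → ℚₚ.+-inverseˡ (seq a n)) , (≡⇒≈ℝ λ n → ℚₚ.+-inverseˡ (seq b n)))
                    , (λ (a +i b) → (≡⇒≈ℝ λ n → ℚₚ.+-inverseʳ (seq a n)) , (≡⇒≈ℝ λ n → ℚₚ.+-inverseʳ (seq b n)))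
          ; ⁻¹-cong = λ { {a +i b} {c +i d} (p , q) → -ℝ-cong {a} {c} p , -ℝ-cong {b} {d} q }
          }
        ; comm = λ (a +i b) (c +i d) →
            (≡⇒≈ℝ λ n → ℚₚ.+-comm (seq a n) (seq c n)) , (≡⇒≈ℝ λ n → ℚₚ.+-comm (seq b n) (seq d n))
        }
      ; *-cong     = *-cong
      ; *-assoc    = *-assoc
      ; *-identity = *-identityˡ , *-identityʳ
      ; distrib    = distribˡ , distribʳ
      }
    ; *-comm = *-comm
    }

-- The pair ±√n in ℂ and the theorem for graphs

module ℂ-Ring = RawRing ℂ-rawRing

seq-re-fromℕ : ∀ n k → seq (re (fromℕ ℂ-rawRing n)) k ≡ seq (fromℕ ℝ-rawRing n) k
seq-re-fromℕ zero    k = ≡.refl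
seq-re-fromℕ (suc n) k = ≡.cong (1ℚ ℚ.+_) (seq-re-fromℕ n k)

seq-im-fromℕ : ∀ n k → seq (im (fromℕ ℂ-rawRing n)) k ≡ 0ℚ
seq-im-fromℕ zero    k = ≡.refl
seq-im-fromℕ (suc n) k = ≡.cong (0ℚ ℚ.+_) (seq-im-fromℕ n k)

ofℝ-+-neg : ∀ x → ofℝ x ℂ-Ring.+ ofℝ (-ℝ x) ℂ-Ring.≈ ℂ-Ring.0#
ofℝ-+-neg x = (≡⇒≈ℝ λ n → ℚₚ.+-inverseʳ (seq x n)) , (≡⇒≈ℝ λ n → ≡.refl)

ofℝ-*-neg : ∀ x n → IsSqrt x n → ofℝ x ℂ-Ring.* ofℝ (-ℝ x) ℂ-Ring.≈ ℂ-Ring.- fromℕ ℂ-rawRing n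
ofℝ-*-neg x n (_ , x²≈n) =
  ≈ℝ-resp {u = -ℝ (x *ℝ x)} {v = -ℝ fromℕ ℝ-rawRing n}
    (λ k → ℚ-Identities.x[-x]-00 (seq x k))
    (λ k → ≡.cong ℚ.-_ (seq-re-fromℕ n k))
    (-ℝ-cong {x *ℝ x} {fromℕ ℝ-rawRing n} x²≈n) ,
  (≡⇒≈ℝ λ k → ≡.trans (ℚ-Identities.x0+0y (seq x k) (ℚ.- seq x k)) (≡.cong ℚ.-_ (≡.sym (seq-im-fromℕ n k))))

module ℂ-JoinSpectrum = JoinSpectrum ℂ-rawRing (CommutativeRing.isCommutativeRing ℂ-commutativeRing)

quartic-zeros : ∀ q₁ q₂ q₃ q₄ ν₁ ν₂ ε₁ ε₂ as → IsMultisetOfZeros (quartic q₁ q₂ q₃ q₄ ν₁ ν₂ ε₁ ε₂) as →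
                IsMultisetOfZeros (ℂ-JoinSpectrum.quarticPoly q₁ q₂ q₃ q₄ ν₁ ν₂ ε₁ ε₂) as
quartic-zeros _ _ _ _ _ _ _ _ _ zeros = zeros

-- Transporting along this equation keeps Agda from expanding the product of the linear factors.
±-first : ∀ {k} x (xs : Vec ℝ k) h →
  map ofℝ (± (toList (x ∷ xs)) ++ replicate h 0ℝ) ≡ map ofℝ (x ∷ (-ℝ x) ∷ ± (toList xs) ++ replicate h 0ℝ)
±-first x xs h = ≡.refl

open import Data.Nat.Base using (_+_; _*_; _∸_)

theorem3p1 :
    ∀ (n₁ n₂ q₁ q₂ n₃ n₄ q₃ q₄ j₁ j₂ : ℕ) →
    let ν₁ = n₁ + n₂
        ν₂ = n₃ + n₄
        ε₁ = n₁ * q₁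
        ε₂ = n₃ * q₃
        k₁ = suc j₁
        k₂ = suc j₂
    in
    1 ℕ.≤ q₁ → 1 ℕ.≤ q₂ → 1 ℕ.≤ q₃ → 1 ℕ.≤ q₄ →
    (G₁ : Graph ν₁) (V₁ V₂ : Subset ν₁) →
    IsSemiRegularBipartite G₁ V₁ V₂ q₁ q₂ →
    ∣ V₁ ∣ ≡ n₁ → ∣ V₂ ∣ ≡ n₂ → n₁ ℕ.≤ n₂ →
    (G₂ : Graph ν₂) (V₃ V₄ : Subset ν₂) →
    IsSemiRegularBipartite G₂ V₃ V₄ q₃ q₄ →
    ∣ V₃ ∣ ≡ n₃ → ∣ V₄ ∣ ≡ n₄ → n₃ ℕ.≤ n₄ →
    (λs : Vec ℝ k₁) →
    IsSpectrum G₁ (map ofℝ (± (toList λs) ++ replicate (ν₁ ∸ 2 * k₁) 0ℝ)) →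
    IsSqrt (head λs) (q₁ * q₂) → Linked _≥_ λs → All (0ℝ <_) λs →
    (μs : Vec ℝ k₂) →
    IsSpectrum G₂ (map ofℝ (± (toList μs) ++ replicate (ν₂ ∸ 2 * k₂) 0ℝ)) →
    IsSqrt (head μs) (q₃ * q₄) → Linked _≥_ μs → All (0ℝ <_) μs →
    (θs : Vec ℂ 4) →
    IsMultisetOfZeros (quartic q₁ q₂ q₃ q₄ ν₁ ν₂ ε₁ ε₂) (toList θs) →
    IsSpectrum (G₁ ∨ G₂)
      (toList θs ++
       map ofℝ (± (toList (tail λs)) ++ ± (toList (tail μs)) ++
                replicate ((ν₁ ∸ 2 * k₁) + (ν₂ ∸ 2 * k₂)) 0ℝ))
theorem3p1 n₁ n₂ q₁ q₂ n₃ n₄ q₃ q₄ j₁ j₂ _ _ _ _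
  G₁ V₁ V₂ semiRegular₁ ∣V₁∣≡n₁ _ _ G₂ V₃ V₄ semiRegular₂ ∣V₃∣≡n₃ _ _
  (l ∷ ls) spectrum₁ l-sqrt _ _ (m ∷ ms) spectrum₂ m-sqrt _ _ θs θ-zeros =
  ℂ-JoinSpectrum.join-spectrum
    {V₁ = V₁} {V₂} {V₃} {V₄} {q₁} {q₂} {q₃} {q₄} semiRegular₁ semiRegular₂ ofℝ
    {l} { -ℝ l} {m} { -ℝ m} {0ℝ}
    (ofℝ-+-neg l) (ofℝ-*-neg l (q₁ * q₂) l-sqrt) (ofℝ-+-neg m) (ofℝ-*-neg m (q₃ * q₄) m-sqrt)
    (± (toList ls)) (± (toList ms)) (n₁ + n₂ ∸ 2 * suc j₁) (n₃ + n₄ ∸ 2 * suc j₂) (toList θs)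
    (≡.subst (IsSpectrum G₁) (±-first l ls (n₁ + n₂ ∸ 2 * suc j₁)) spectrum₁)
    (≡.subst (IsSpectrum G₂) (±-first m ms (n₃ + n₄ ∸ 2 * suc j₂)) spectrum₂)
    (quartic-zeros q₁ q₂ q₃ q₄ (n₁ + n₂) (n₃ + n₄) (∣ V₁ ∣ * q₁) (∣ V₃ ∣ * q₃) (toList θs)
      -- The edge numbers are given as n₁q₁ and n₃q₃, while the determinant identity yields them
      -- from the sizes of `V₁` and `V₃`. Only these arguments are transported: the vertex numbers
      -- n₁ + n₂ and n₃ + n₄ already index the types of the graphs.
      (≡.subst₂ (λ v₁ v₃ → IsMultisetOfZeros (quartic q₁ q₂ q₃ q₄ (n₁ + n₂) (n₃ + n₄) (v₁ * q₁) (v₃ * q₃)) (toList θs))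
                {n₁} {∣ V₁ ∣} {n₃} {∣ V₃ ∣} (≡.sym ∣V₁∣≡n₁) (≡.sym ∣V₃∣≡n₃) θ-zeros))
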